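{- Let $\lambda\ge 2$ be a fixed integer, and let $\kappa_{n,\lambda}$ denote the minimum number of $(n+1)$-permutations needed to cover each $n$-permutation $\lambda$ times. Then, as $n\to\infty$, $$\kappa_{n,\lambda}\le\frac{(n+1)!}{n^2}\bigl(\log n+(\lambda-1)\log\log n+O(1)\bigr).$$
   Context: $S_n$ is the set of all permutations of $[n]=\{1,2,\ldots,n\}$, written as words; its elements are called $n$-permutations. A permutation $\rho\in S_{n+1}$ covers $\pi\in S_n$ if $\rho$ has a (not necessarily contiguous) subsequence of length $n$ that is order-isomorphic to $\pi$. The number $\kappa_{n,\lambda}$ is the smallest cardinality of a set $\mathcal{A}\subseteq S_{n+1}$ such that every $\pi\in S_n$ is covered by at least $\lambda$ distinct elements of $\mathcal{A}$ (such a set exists for all sufficiently large $n$). $\log$ is the natural logarithm; the constant implied by $O(1)$ may depend on $\lambda$. -}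

module Defs where

import Algebra.Definitions.RawSemiring as RawSemiring
open import Data.Fin.Base as Fin using (Fin)
open import Data.Integer.Base using (+_)
open import Data.List.Base using (List; length)
open import Data.List.Membership.Propositional using (_∈_)
open import Data.List.Relation.Binary.Sublist.Propositional using (_⊆_)
open import Data.List.Relation.Unary.All using (All)
open import Data.List.Relation.Unary.Unique.Propositional using (Unique)
open import Data.Nat.Base as ℕ using (ℕ; zero; suc; _!)
open import Data.Nat.Properties using (_!≢0)
open import Data.Product.Base using (Σ; ∃-syntax; _×_; _,_; proj₁)
open import Data.Rational.Base as ℚ using (ℚ; 0ℚ; _+_; _*_; _<_; +-*-rawSemiring)
open import Data.Rational.Properties using (<-trans; <-dense)
open import Data.Unit.Base using (⊤)
open import Data.Vec.Base using (Vec; lookup; toList)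
import Data.Vec.Relation.Unary.Unique.Propositional as Vec
open import Function.Bundles using (_⇔_)
open import Relation.Binary.PropositionalEquality.Core using (_≡_)

open RawSemiring +-*-rawSemiring using (_^_)

-- The letters 1, …, n are represented by the elements of Fin n.
record Perm (n : ℕ) : Set where
  constructor perm
  field
    word      : Vec (Fin n) n
    .distinct : Vec.Unique word

open Perm public

OrderIsomorphic : ∀ {a b n} → Vec (Fin a) n → Vec (Fin b) n → Set
OrderIsomorphic u v =
  ∀ i j → (lookup u i Fin.< lookup u j) ⇔ (lookup v i Fin.< lookup v j)

-- On lists, _⊆_ is the (not necessarily contiguous) subsequence relation.
Covers : ∀ {n} → Perm (suc n) → Perm n → Set
Covers {n} ρ π =
  Σ (Vec (Fin (suc n)) n) λ w →
    toList w ⊆ toList (word ρ) × OrderIsomorphic w (word π)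

-- Finite sets of permutations are duplicate-free lists, so that cardinality
-- is length.
CoversTimes : ∀ {n} → ℕ → List (Perm (suc n)) → Perm n → Set
CoversTimes ℓ A π =
  ∃[ B ] Unique B × ℓ ℕ.≤ length B × All (λ ρ → ρ ∈ A × Covers ρ π) B

IsCovering : (n ℓ : ℕ) → List (Perm (suc n)) → Set
IsCovering n ℓ A = Unique A × (∀ (π : Perm n) → CoversTimes ℓ A π)

record IsMinimum (P : ℕ → Set) (k : ℕ) : Set where
  field
    attained : P k
    minimal  : ∀ m → P m → k ℕ.≤ m

-- A relation rather than a function of n and ℓ: for small n there may be no
-- covering at all.
IsKappa : (n ℓ : ℕ) → ℕ → Set
IsKappa n ℓ = IsMinimum λ k → ∃[ A ] IsCovering n ℓ A × length A ≡ k

-- Extended reals as Dedekind cuts, given by the set of rationals strictly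
-- below: the empty set is -∞, the set of all rationals is +∞.  Allowing ±∞
-- makes suprema, and hence log, total.
record ℝ̄ : Set₁ where
  field
    Below   : ℚ → Set
    lower   : ∀ {p q} → p < q → Below q → Below p
    rounded : ∀ {p} → Below p → ∃[ q ] p < q × Below q

open ℝ̄ public

infix  4 _≤ᴿ_ _<ᴿ_
infixl 6 _+ᴿ_
infixl 7 _/_·_

_≤ᴿ_ : ℝ̄ → ℝ̄ → Set
x ≤ᴿ y = ∀ {q} → Below x q → Below y q

⨆ : {I : Set} → (I → ℚ) → ℝ̄
⨆ f .Below p = ∃[ i ] p < f i
⨆ f .lower p<q (i , q<fi) = i , <-trans p<q q<fi
⨆ f .rounded (i , p<fi) with q , p<q , q<fi ← <-dense p<fi = q , p<q , i , q<fi

↑_ : ℚ → ℝ̄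
↑ q = ⨆ {⊤} λ _ → q

fromℕ : ℕ → ℝ̄
fromℕ m = ↑ (+ m ℚ./ 1)

-- Constructive strict order: some rational separates x from y.
_<ᴿ_ : ℝ̄ → ℝ̄ → Set
x <ᴿ y = ∃[ r ] x ≤ᴿ ↑ r × Below y r

_+ᴿ_ : ℝ̄ → ℝ̄ → ℝ̄
x +ᴿ y = ⨆ {Σ ℚ (Below x) × Σ ℚ (Below y)} λ ((p , _) , (q , _)) → p + q

-- m / d · x is the product of the fraction m/d with x.  Multiplying the cut
-- elementwise is correct because m/d ≥ 0.
_/_·_ : (m d : ℕ) .{{_ : ℕ.NonZero d}} → ℝ̄ → ℝ̄
m / d · x = ⨆ {Σ ℚ (Below x)} λ (q , _) → (+ m ℚ./ d) * q

-- This is the limit inferior, hence the limit of a convergent sequence.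
lim : (ℕ → ℚ) → ℝ̄
lim a = ⨆ {∃[ s ] ∃[ K ] ∀ k → K ℕ.≤ k → s ℚ.≤ a k} proj₁

expSum : ℚ → ℕ → ℚ
expSum q zero    = 0ℚ
expSum q (suc k) = expSum q k + q ^ k * (+ 1 ℚ./ k !) {{k !≢0}}

exp : ℚ → ℝ̄
exp q = lim (expSum q)

-- The inverse of exp, with log x = -∞ for x ≤ 0.  It is enough to take
-- rational exponents, since exp is continuous and increasing.
log : ℝ̄ → ℝ̄
log x = ⨆ {∃[ q ] exp q <ᴿ x} proj₁

-- Keep every (n+1)-permutation independently with probability p = x / n² and
-- repair each π that is covered fewer than ℓ times by adding ℓ of its covers.
-- A permutation has at least n² covers, so for z = 1 / x Chernoff's bound makes
-- π deficient with probability at most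
--   x^(ℓ-1) (1 - p + p z)^(n²) = x^(ℓ-1) (1 - (x - 1) / n²)^(n²).
-- For x = 1 + h(n) + (ℓ-1) h(log n), with h the harmonic numbers, this is O(1/n):
-- (1 - 1/(i M))^M ≤ i/(i+1), and these factors telescope.  The repairs thus
-- contribute O((n+1)!/n²), while exp (1/i) ≤ i/(i-1), which telescopes as well,
-- bounds h by the logarithm.  The expectation is derandomised entry by entry,
-- which keeps the whole argument rational and constructive.
module Submission where

open import Defs
import Algebra.Definitions.RawSemiring as RawSemiring
import Algebra.Properties.CommutativeSemiring.Exp as Exp
open import Algebra.Bundles using (CommutativeRing)
open import Data.Fin.Base as Fin using (Fin; zero; suc; punchIn; punchOut; inject₁)
import Data.Fin.Properties as Fin
import Data.Integer.Base as ℤ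
import Data.Integer.Properties as ℤ
open import Data.List.Base
  using (List; []; _∷_; [_]; _++_; length; map; filter; take; allFin; concatMap; cartesianProductWith; deduplicate)
import Data.List.Membership.DecPropositional as DecMembership
open import Data.List.Membership.Propositional using (_∈_; lose)
open import Data.List.Membership.Propositional.Properties
open import Data.List.Properties using (length-++; length-map; length-take; length-tabulate; length-deduplicate)
import Data.List.Relation.Binary.Sublist.DecPropositional as DecSublist
open import Data.List.Relation.Binary.Sublist.Propositional using (_⊆_; []; _∷_; _∷ʳ_; ⊆-refl)
import Data.List.Relation.Binary.Sublist.Propositional.Properties as Sublist
open import Data.List.Relation.Unary.All as All using (All; []; _∷_)
import Data.List.Relation.Unary.All.Properties as All
open import Data.List.Relation.Unary.AllPairs using ([]; _∷_)
open import Data.List.Relation.Unary.Any using (here; there)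
import Data.List.Relation.Unary.Unique.DecPropositional.Properties as DecUnique
open import Data.List.Relation.Unary.Unique.Propositional using (Unique)
import Data.List.Relation.Unary.Unique.Propositional.Properties as Unique
open import Data.Nat.Base as ℕ using (ℕ; zero; suc; _≤_; _∸_; _^_; _!; NonZero; z≤n; s≤s)
import Data.Nat.Properties as ℕ
open import Data.Nat.Properties using (m^n≢0)
import Data.Nat.Solver as ℕ
open import Data.Product.Base using (∃; ∃-syntax; _×_; _,_; proj₂)
open import Data.Rational.Base as ℚ using (ℚ; 0ℚ; 1ℚ; _+_; _*_; _-_; -_; +-*-rawSemiring; toℚᵘ)
import Data.Rational.Properties as ℚ
open import Data.Rational.Solver using (module +-*-Solver)
import Data.Rational.Unnormalised.Base as ℚᵘ
import Data.Rational.Unnormalised.Properties as ℚᵘ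
open import Data.Sum.Base using (_⊎_; inj₁; inj₂; [_,_]′)
open import Data.Unit.Base using (tt)
open import Data.Vec.Base as Vec using (Vec; []; _∷_; lookup; toList; insertAt)
import Data.Vec.Properties as Vec
import Data.Vec.Relation.Unary.All as VecAll
import Data.Vec.Relation.Unary.All.Properties as VecAll
import Data.Vec.Relation.Unary.AllPairs as VecAllPairs
import Data.Vec.Relation.Unary.Unique.Propositional as Vec
import Data.Vec.Relation.Unary.Unique.Propositional.Properties as Vec
open import Function.Base using (_∘_; id)
open import Function.Bundles using (mk⇔; Equivalence)
open import Relation.Binary.Definitions using (tri<; tri≈; tri>)
open import Relation.Binary.PropositionalEquality
  using (_≡_; _≢_; refl; sym; trans; cong; cong₂; subst; module ≡-Reasoning)
open import Relation.Nullary.Decidable using (Dec; yes; no; map′; ¬?; _×-dec_; _→-dec_; recompute; from-yes)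
open import Relation.Nullary.Negation.Core using (¬_; contradiction)
open import Relation.Unary using (Decidable)

open RawSemiring +-*-rawSemiring using () renaming (_^_ to _^ᵠ_)
open Exp (CommutativeRing.commutativeSemiring ℚ.+-*-commutativeRing) using (^-distrib-*; ^-assocʳ)
open +-*-Solver using (solve; con; _:=_; _:+_; _:*_; _:-_)

-- Put r = ℓ - 1 and m = n - 2. The decay from `harmonic m` alone is O(1/n), but the Chernoff factor
-- x^r may be as large as a constant times (log n)^r and has to be won back; the r copies of h(log
-- n) do this. As log n is only a cut, an integer L with L + 1 < `harmonic m` ≤ L + 3 stands in for
-- it. The upper bound keeps x within a constant multiple of L + 2, and the r copies of `harmonic L`
-- cancel the r-th power of L + 2. The lower bound makes `harmonic L` at most log log n. Logarithms
-- occur only on the larger side of the final inequality, so it is enough to exhibit rationals below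
-- them, and no logarithm is ever bounded from above.

private variable
  A : Set
  m n : ℕ
  a b c d : ℚ

-- Lists

-- Pigeonhole principle: cutting x out of ys leaves a list that still contains the tail, because x
-- does not recur there.
Unique-length-≤ : {xs ys : List A} → Unique xs → (∀ {x} → x ∈ xs → x ∈ ys) → length xs ≤ length ys
Unique-length-≤ {xs = []} _ _ = z≤n
Unique-length-≤ {xs = x ∷ xs} (x∉ ∷ u) xs⊆ys with as , bs , refl ← ∈-∃++ (xs⊆ys (here refl)) =
  subst (suc (length xs) ≤_) lengths (s≤s (Unique-length-≤ u sub))
  where
  lengths : suc (length (as ++ bs)) ≡ length (as ++ x ∷ bs)
  lengths = trans (cong suc (length-++ as)) (sym (trans (length-++ as) (ℕ.+-suc (length as) (length bs))))
  sub : ∀ {y} → y ∈ xs → y ∈ as ++ bs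
  sub y∈xs with ∈-++⁻ as (xs⊆ys (there y∈xs))
  ... | inj₁ y∈as = ∈-++⁺ˡ y∈as
  ... | inj₂ (here refl) = contradiction y∈xs (Unique.Unique[x∷xs]⇒x∉xs (x∉ ∷ u))
  ... | inj₂ (there y∈bs) = ∈-++⁺ʳ as y∈bs

ShortestSublist : List A → (List A → Set) → Set
ShortestSublist xs Q = ∃[ S ] S ⊆ xs × Q S × (∀ T → T ⊆ xs → Q T → length S ≤ length T)

-- Constructively the minimum has to be found by search. As Q is arbitrary, the branch that keeps x
-- can recurse with the predicate `Q ∘ (x ∷_)`.
shortestSublist : {Q : List A → Set} → Decidable Q → ∀ xs →
                  (∀ S → S ⊆ xs → ¬ Q S) ⊎ ShortestSublist xs Q
shortestSublist Q? [] with Q? []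
... | yes q = inj₂ ([] , [] , q , λ _ _ _ → z≤n)
... | no ¬q = inj₁ λ where [] [] q → ¬q q
shortestSublist Q? (x ∷ xs) with shortestSublist (Q? ∘ (x ∷_)) xs | shortestSublist Q? xs
... | inj₁ none∷ | inj₁ none = inj₁ λ where
  S (_ ∷ʳ τ) q → none S τ q
  (_ ∷ S) (refl ∷ τ) q → none∷ S τ q
... | inj₁ none∷ | inj₂ (S , τ , q , min) = inj₂ (S , x ∷ʳ τ , q , λ where
  T (_ ∷ʳ ρ) → min T ρ
  (_ ∷ T) (refl ∷ ρ) r → contradiction r (none∷ T ρ))
... | inj₂ (S , τ , q , min) | inj₁ none = inj₂ (x ∷ S , refl ∷ τ , q , λ where
  T (_ ∷ʳ ρ) r → contradiction r (none T ρ)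
  (_ ∷ T) (refl ∷ ρ) r → s≤s (min T ρ r))
... | inj₂ (S , τ , q , min) | inj₂ (S′ , τ′ , q′ , min′) with ℕ.≤-total (length (x ∷ S)) (length S′)
...   | inj₁ x∷S≤S′ = inj₂ (x ∷ S , refl ∷ τ , q , λ where
  T (_ ∷ʳ ρ) r → ℕ.≤-trans x∷S≤S′ (min′ T ρ r)
  (_ ∷ T) (refl ∷ ρ) r → s≤s (min T ρ r))
...   | inj₂ S′≤x∷S = inj₂ (S′ , x ∷ʳ τ′ , q′ , λ where
  T (_ ∷ʳ ρ) r → min′ T ρ r
  (_ ∷ T) (refl ∷ ρ) r → ℕ.≤-trans S′≤x∷S (s≤s (min T ρ r)))

-- Permutations and their covers

length-cartesianProductWith : {A B C : Set} (f : A → B → C) (xs : List A) (ys : List B) →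
  length (cartesianProductWith f xs ys) ≡ length xs ℕ.* length ys
length-cartesianProductWith f []       ys = refl
length-cartesianProductWith f (x ∷ xs) ys =
  trans (length-++ (map (f x) ys))
        (cong₂ ℕ._+_ (length-map (f x) ys) (length-cartesianProductWith f xs ys))

punchIn-mono-< : ∀ (a : Fin (suc n)) {i j} → i Fin.< j → punchIn a i Fin.< punchIn a j
punchIn-mono-< a {i} {j} i<j = ℕ.≰⇒> λ j≤i → ℕ.<⇒≱ i<j (Fin.punchIn-cancel-≤ a j i j≤i)

punchIn-cancel-< : ∀ (a : Fin (suc n)) {i j} → punchIn a i Fin.< punchIn a j → i Fin.< j
punchIn-cancel-< a {i} {j} i<j = ℕ.≰⇒> λ j≤i → ℕ.<⇒≱ i<j (Fin.punchIn-mono-≤ a j i j≤i)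

punchIn-≤ : ∀ (i : Fin (suc n)) (j : Fin n) → i Fin.≤ inject₁ j → punchIn i j ≡ suc j
punchIn-≤ zero    _       _         = refl
punchIn-≤ (suc i) (suc j) (s≤s i≤j) = cong suc (punchIn-≤ i j i≤j)

punchIn-inject₁ : ∀ (j : Fin n) → punchIn (inject₁ j) j ≡ suc j
punchIn-inject₁ j = punchIn-≤ (inject₁ j) j ℕ.≤-refl

punchIn-adjacent : ∀ (a : Fin (suc n)) (v : Fin n) → punchIn a v ≡ inject₁ v ⊎ punchIn a v ≡ suc v
punchIn-adjacent zero    v       = inj₂ refl
punchIn-adjacent (suc a) zero    = inj₁ refl
punchIn-adjacent (suc a) (suc v) with punchIn-adjacent a v
... | inj₁ eq = inj₁ (cong suc eq)
... | inj₂ eq = inj₂ (cong suc eq)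

word-injective : {π σ : Perm n} → word π ≡ word σ → π ≡ σ
word-injective refl = refl

_≟ᴾ_ : (π σ : Perm n) → Dec (π ≡ σ)
π ≟ᴾ σ = map′ word-injective (cong word) (Vec.≡-dec Fin._≟_ (word π) (word σ))

vecUnique? : Decidable (Vec.Unique {A = Fin m} {n = n})
vecUnique? = VecAllPairs.allPairs? λ x y → ¬? (x Fin.≟ y)

-- The field `distinct` is irrelevant, so a usable proof is recomputed from the decidability of
-- distinctness.
word-unique : (π : Perm n) → Vec.Unique (word π)
word-unique (perm w u) = recompute (vecUnique? w) u

All-insertAt : {A : Set} {P : A → Set} {a : A} {w : Vec A n} (i : Fin (suc n)) →
               P a → VecAll.All P w → VecAll.All P (insertAt w i a)
All-insertAt zero    pa pw              = pa VecAll.∷ pw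
All-insertAt (suc i) pa (px VecAll.∷ pw) = px VecAll.∷ All-insertAt i pa pw

insertAt-unique : {A : Set} {a : A} {w : Vec A n} (i : Fin (suc n)) →
                  VecAll.All (a ≢_) w → Vec.Unique w → Vec.Unique (insertAt w i a)
insertAt-unique zero    a∉w u = a∉w VecAllPairs.∷ u
insertAt-unique (suc i) (a≢x VecAll.∷ a∉w) (x∉w VecAllPairs.∷ u) =
  All-insertAt i (a≢x ∘ sym) x∉w VecAllPairs.∷ insertAt-unique i a∉w u

punchIn-avoids : (a : Fin (suc n)) (w : Vec (Fin n) m) → VecAll.All (a ≢_) (Vec.map (punchIn a) w)
punchIn-avoids a w = VecAll.map⁺ (VecAll.universal (λ v a≡ → Fin.punchInᵢ≢i a v (sym a≡)) w)

insertLetter : Fin (suc n) → Fin (suc n) → Perm n → Perm (suc n)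
insertLetter i a π = perm (insertAt (Vec.map (punchIn a) (word π)) i a)
  (insertAt-unique i (punchIn-avoids a (word π)) (Vec.map⁺ (Fin.punchIn-injective a _ _) (word-unique π)))

perms : ∀ n → List (Perm n)
perms zero    = [ perm [] VecAllPairs.[] ]
perms (suc n) = cartesianProductWith (insertLetter zero) (allFin (suc n)) (perms n)

length-perms : ∀ n → length (perms n) ≡ n !
length-perms zero    = refl
length-perms (suc n) = trans (length-cartesianProductWith (insertLetter zero) (allFin (suc n)) (perms n))
  (cong₂ ℕ._*_ (length-tabulate {n = suc n} id) (length-perms n))

punchOutAll : {a : Fin (suc n)} {w : Vec (Fin (suc n)) m} →
              VecAll.All (a ≢_) w → ∃[ v ] Vec.map (punchIn a) v ≡ w
punchOutAll VecAll.[] = [] , refl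
punchOutAll {a = a} (a≢x VecAll.∷ a∉w) with v , eq ← punchOutAll a∉w =
  punchOut a≢x ∷ v , cong₂ _∷_ (Fin.punchIn-punchOut a≢x) eq

map-unique⁻ : {A B : Set} {f : A → B} {w : Vec A n} → Vec.Unique (Vec.map f w) → Vec.Unique w
map-unique⁻ {w = []}    VecAllPairs.[] = VecAllPairs.[]
map-unique⁻ {f = f} {w = x ∷ w} (x∉w VecAllPairs.∷ u) =
  VecAll.map (_∘ cong f) (VecAll.map⁻ x∉w) VecAllPairs.∷ map-unique⁻ u

∈-perms : (π : Perm n) → π ∈ perms n
∈-perms {zero}  (perm [] _) = here refl
∈-perms {suc n} π@(perm (a ∷ w) _) with a∉w VecAllPairs.∷ u ← word-unique π with v , refl ← punchOutAll a∉w =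
  ∈-cartesianProductWith⁺ (insertLetter zero) (∈-allFin a) (∈-perms (perm v (map-unique⁻ u)))

map-injective : {A B : Set} {f : A → B} → (∀ {x y} → f x ≡ f y → x ≡ y) →
                {v w : Vec A n} → Vec.map f v ≡ Vec.map f w → v ≡ w
map-injective f-inj {[]}    {[]}    _  = refl
map-injective f-inj {x ∷ v} {y ∷ w} eq =
  cong₂ _∷_ (f-inj (Vec.∷-injectiveˡ eq)) (map-injective f-inj (Vec.∷-injectiveʳ eq))

insertLetter-zero-injective : ∀ {a b : Fin (suc n)} {π σ} →
                              insertLetter zero a π ≡ insertLetter zero b σ → a ≡ b × π ≡ σ
insertLetter-zero-injective {a = a} eq with refl ← Vec.∷-injectiveˡ (cong word eq) =
  refl , word-injective (map-injective (Fin.punchIn-injective a _ _) (Vec.∷-injectiveʳ (cong word eq)))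

perms-unique : ∀ n → Unique (perms n)
perms-unique zero    = [] ∷ []
perms-unique (suc n) = Unique.cartesianProductWith⁺ (insertLetter zero) insertLetter-zero-injective
  (Unique.allFin⁺ (suc n)) (perms-unique n)

-- Decidability of the covering relation

∃-Vec? : {P : Vec (Fin m) n → Set} → Decidable P → Dec (∃ P)
∃-Vec? {n = zero}  P? = map′ ([] ,_) (λ where ([] , p) → p) (P? [])
∃-Vec? {n = suc n} P? =
  map′ (λ (x , w , p) → x ∷ w , p) (λ where (x ∷ w , p) → x , w , p)
       (Fin.any? λ x → ∃-Vec? (P? ∘ (x ∷_)))

orderIsomorphic? : ∀ {a b} (u : Vec (Fin a) n) (v : Vec (Fin b) n) → Dec (OrderIsomorphic u v)
orderIsomorphic? u v = Fin.all? λ i → Fin.all? λ j →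
  map′ (λ (f , g) → mk⇔ f g) (λ e → Equivalence.to e , Equivalence.from e)
       (((lookup u i Fin.<? lookup u j) →-dec (lookup v i Fin.<? lookup v j)) ×-dec
        ((lookup v i Fin.<? lookup v j) →-dec (lookup u i Fin.<? lookup u j)))

abstract
  -- Only decidability is used later; `abstract` keeps the search through all words from unfolding.
  covers? : (π : Perm n) → Decidable (λ ρ → Covers ρ π)
  covers? π ρ = ∃-Vec? λ w →
    DecSublist._⊆?_ Fin._≟_ (toList w) (toList (word ρ)) ×-dec orderIsomorphic? w (word π)

-- Covers obtained by inserting a letter

toList-⊆-insertAt : {A : Set} (w : Vec A n) (i : Fin (suc n)) (a : A) →
                    toList w ⊆ toList (insertAt w i a)
toList-⊆-insertAt w       zero    a = a ∷ʳ ⊆-refl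
toList-⊆-insertAt (x ∷ w) (suc i) a = refl ∷ toList-⊆-insertAt w i a

insertLetter-covers : ∀ i a (π : Perm n) → Covers (insertLetter i a π) π
insertLetter-covers i a π = Vec.map (punchIn a) (word π) , toList-⊆-insertAt _ i a , iso
  where
  iso : OrderIsomorphic (Vec.map (punchIn a) (word π)) (word π)
  iso j k rewrite Vec.lookup-map j (punchIn a) (word π) | Vec.lookup-map k (punchIn a) (word π) =
    mk⇔ (punchIn-cancel-< a) (punchIn-mono-< a)

insertLetter-letter : ∀ {i} {a b : Fin (suc n)} {π} → insertLetter i a π ≡ insertLetter i b π → a ≡ b
insertLetter-letter {i = i} {a} {b} {π} eq = begin
  a                               ≡⟨ Vec.insertAt-lookup _ i a ⟨
  lookup (word (insertLetter i a π)) i ≡⟨ cong (λ ρ → lookup (word ρ) i) eq ⟩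
  lookup (word (insertLetter i b π)) i ≡⟨ Vec.insertAt-lookup _ i b ⟩
  b                               ∎ where open ≡-Reasoning

-- An insertion at or before place j pushes the letter of π at j to place j + 1, exactly where the
-- other word carries b.
insertLetter-before : ∀ {i a b} {j : Fin n} {π} → i Fin.≤ inject₁ j →
                      insertLetter i a π ≡ insertLetter (suc j) b π → b ≡ punchIn a (lookup (word π) j)
insertLetter-before {i = i} {a} {b} {j} {π} i≤j eq = begin
  b                                            ≡⟨ Vec.insertAt-lookup (Vec.map (punchIn b) (word π)) (suc j) b ⟨
  lookup (word (insertLetter (suc j) b π)) (suc j) ≡⟨ cong (λ ρ → lookup (word ρ) (suc j)) eq ⟨
  lookup (word (insertLetter i a π)) (suc j)
    ≡⟨ cong (lookup (word (insertLetter i a π))) (punchIn-≤ i j i≤j) ⟨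
  lookup (word (insertLetter i a π)) (punchIn i j)
    ≡⟨ Vec.insertAt-punchIn (Vec.map (punchIn a) (word π)) i a j ⟩
  lookup (Vec.map (punchIn a) (word π)) j      ≡⟨ Vec.lookup-map j (punchIn a) (word π) ⟩
  punchIn a (lookup (word π) j)                ∎ where open ≡-Reasoning

-- The outer `punchIn` skips `inject₁ v`. Since it sends v to `suc v`, the inner one, which skips v,
-- excludes `suc v` as well. These are the only two values that `punchIn a v` can take.
nonAdjacent : Fin (suc n) → Fin n → Fin (suc (suc n))
nonAdjacent v c = punchIn (inject₁ v) (punchIn v c)

nonAdjacent-≢ : ∀ (a : Fin (suc (suc n))) v c → nonAdjacent v c ≢ punchIn a v
nonAdjacent-≢ a v c eq with punchIn-adjacent a v
... | inj₁ a≡v = Fin.punchInᵢ≢i (inject₁ v) _ (trans eq a≡v)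
... | inj₂ a≡v = Fin.punchInᵢ≢i v c
  (Fin.punchIn-injective (inject₁ v) _ _ (trans eq (trans a≡v (sym (punchIn-inject₁ v)))))

-- Inserting next to a letter v one of the values that become v or v + 1
-- repeats an insertion further to the left, so these are left out.
coverings : Perm n → List (Perm (suc n))
coverings {zero}  π = [ insertLetter zero zero π ]
coverings {suc n} π =
  map (λ a → insertLetter zero a π) (allFin (suc (suc n))) ++
  cartesianProductWith (λ j c → insertLetter (suc j) (nonAdjacent (lookup (word π) j) c) π)
    (allFin (suc n)) (allFin n)

length-coverings : (π : Perm n) → n ℕ.^ 2 ℕ.≤ length (coverings π)
length-coverings {zero}  π = z≤n
length-coverings {suc n} π = begin
  suc n ℕ.^ 2                               ≡⟨ cong (suc n ℕ.*_) (ℕ.*-identityʳ (suc n)) ⟩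
  suc n ℕ.* suc n                           ≡⟨ ℕ.*-suc (suc n) n ⟩
  -- For length N = n + 1 there are N + 1 insertions in front and N - 1 at each of the N other
  -- places, N² + 1 in all; the spare one is given up here.
  suc n ℕ.+ suc n ℕ.* n                     ≤⟨ ℕ.n≤1+n _ ⟩
  suc (suc n) ℕ.+ suc n ℕ.* n               ≡⟨ cong₂ ℕ._+_ length-front length-back ⟨
  length front ℕ.+ length back              ≡⟨ length-++ front ⟨
  length (front ++ back)                    ∎
  where
  open ℕ.≤-Reasoning
  ins = λ j c → insertLetter (suc j) (nonAdjacent (lookup (word π) j) c) π
  front = map (λ a → insertLetter zero a π) (allFin (suc (suc n)))
  back = cartesianProductWith ins (allFin (suc n)) (allFin n)
  length-front : length front ≡ suc (suc n)
  length-front = trans (length-map _ (allFin (suc (suc n)))) (length-tabulate {n = suc (suc n)} id)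
  length-back : length back ≡ suc n ℕ.* n
  length-back = trans (length-cartesianProductWith ins (allFin (suc n)) (allFin n))
    (cong₂ ℕ._*_ (length-tabulate {n = suc n} id) (length-tabulate {n = n} id))

-- If insertions at two different places agreed, the one further right would have inserted
-- `punchIn a v`, where v is the letter of π just before it; `nonAdjacent` rules this out. At one
-- and the same place the inserted letter can be read off.
coverings-unique : (π : Perm n) → Unique (coverings π)
coverings-unique {zero}  π = [] ∷ []
coverings-unique {suc n} π = Unique.++⁺
  (Unique.map⁺ (insertLetter-letter {i = zero} {π = π}) (Unique.allFin⁺ _))
  (Unique.cartesianProductWith⁺ ins injective (Unique.allFin⁺ _) (Unique.allFin⁺ _))
  disjoint
  where
  ins : Fin (suc n) → Fin n → Perm (suc (suc n))
  ins j c = insertLetter (suc j) (nonAdjacent (lookup (word π) j) c) π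

  ordered : ∀ {j k c d} → j Fin.< k → ins j c ≢ ins k d
  ordered {j} {k} {d = d} j<k eq = nonAdjacent-≢ _ (lookup (word π) k) d
    (insertLetter-before {i = suc j} {π = π} (subst (suc (Fin.toℕ j) ℕ.≤_) (sym (Fin.toℕ-inject₁ k)) j<k) eq)

  injective : ∀ {j k c d} → ins j c ≡ ins k d → j ≡ k × c ≡ d
  injective {j} {k} {c} {d} eq with Fin.<-cmp j k
  ... | tri< j<k _ _ = contradiction eq (ordered {j} {k} {c} {d} j<k)
  ... | tri> _ _ k<j = contradiction (sym eq) (ordered {k} {j} {d} {c} k<j)
  ... | tri≈ _ refl _ = refl , Fin.punchIn-injective _ _ _
    (Fin.punchIn-injective (inject₁ (lookup (word π) j)) _ _ (insertLetter-letter {i = suc j} {π = π} eq))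

  disjoint : ∀ {ρ} → ¬ (ρ ∈ map (λ a → insertLetter zero a π) (allFin (suc (suc n))) ×
                        ρ ∈ cartesianProductWith ins (allFin (suc n)) (allFin n))
  disjoint (l , r) with a , _ , refl ← ∈-map⁻ _ l
                      | j , c , _ , _ , eq ← ∈-cartesianProductWith⁻ ins (allFin (suc n)) (allFin n) r =
    nonAdjacent-≢ a (lookup (word π) j) c (insertLetter-before {i = zero} {π = π} z≤n eq)

coverings-cover : (π : Perm n) → All (λ ρ → Covers ρ π) (coverings π)
coverings-cover {zero}  π = insertLetter-covers zero zero π ∷ []
coverings-cover {suc n} π = All.++⁺
  (All.map⁺ (All.universal (λ a → insertLetter-covers zero a π) (allFin (suc (suc n)))))
  (All.tabulate λ ρ∈ → cover (∈-cartesianProductWith⁻ _ (allFin (suc n)) (allFin n) ρ∈))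
  where
  cover : ∀ {ρ} → ∃[ j ] ∃[ c ] (j ∈ allFin (suc n) × c ∈ allFin n ×
            ρ ≡ insertLetter (suc j) (nonAdjacent (lookup (word π) j) c) π) → Covers ρ π
  cover (j , c , _ , _ , refl) = insertLetter-covers (suc j) _ π

-- Coverings

⊆-unique : {A : Set} {xs ys : List A} → xs ⊆ ys → Unique ys → Unique xs
⊆-unique [] [] = []
⊆-unique (_ ∷ʳ τ) (_ ∷ u) = ⊆-unique τ u
⊆-unique (refl ∷ τ) (x∉ ∷ u) = Sublist.All-resp-⊆ τ x∉ ∷ ⊆-unique τ u

covers : Perm n → List (Perm (suc n)) → List (Perm (suc n))
covers π = filter (covers? π)

CoveredBy : ℕ → List (Perm (suc n)) → Set
CoveredBy {n} ℓ S = All (λ π → ℓ ≤ length (covers π S)) (perms n)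

coveredBy? : ∀ ℓ → Decidable (CoveredBy {n} ℓ)
coveredBy? ℓ S = All.all? (λ π → ℓ ℕ.≤? length (covers π S)) _

length-covers-≥ : (π : Perm n) {B S : List (Perm (suc n))} → Unique B →
                  All (λ ρ → ρ ∈ S × Covers ρ π) B → length B ≤ length (covers π S)
length-covers-≥ π u all = Unique-length-≤ u λ ρ∈B →
  let ρ∈S , c = All.lookup all ρ∈B in ∈-filter⁺ (covers? π) ρ∈S c

covered⇒covering : ∀ {ℓ} {S : List (Perm (suc n))} → Unique S → CoveredBy ℓ S → IsCovering n ℓ S
covered⇒covering {S = S} u cov = u , λ π →
  covers π S , Unique.filter⁺ (covers? π) u , All.lookup cov (∈-perms π) ,
  All.tabulate (∈-filter⁻ (covers? π) {xs = S})

-- A covering may list its permutations in any order. Filtering `perms (suc n)` by membership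
-- reorders it into a sublist that is no longer, so a search through sublists finds the minimum over
-- all coverings; the given covering shows that the search succeeds.
kappa-≤ : ∀ {ℓ A} → IsCovering n ℓ A → ∃[ k ] IsKappa n ℓ k × k ≤ length A
kappa-≤ {n} {ℓ} {A} A-cov = fromShortest (shortestSublist (coveredBy? ℓ) (perms (suc n)))
  where
  open DecMembership _≟ᴾ_ using (_∈?_)

  normalise : List (Perm (suc n)) → List (Perm (suc n))
  normalise A = filter (_∈? A) (perms (suc n))

  normalise-⊆ : ∀ A → normalise A ⊆ perms (suc n)
  normalise-⊆ A = Sublist.filter-⊆ (_∈? A) (perms (suc n))

  length-normalise : ∀ A → length (normalise A) ≤ length A
  length-normalise A = Unique-length-≤ (Unique.filter⁺ (_∈? A) (perms-unique (suc n)))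
    (proj₂ ∘ ∈-filter⁻ (_∈? A) {xs = perms (suc n)})

  normalise-covered : ∀ {A} → IsCovering n ℓ A → CoveredBy ℓ (normalise A)
  normalise-covered {A} (_ , cov) = All.universal (λ π →
    let _ , u , ℓ≤B , all = cov π in
    ℕ.≤-trans ℓ≤B (length-covers-≥ π u (All.map (λ (ρ∈A , c) → ∈-filter⁺ (_∈? A) (∈-perms _) ρ∈A , c) all)))
    _

  fromShortest : _ → ∃[ k ] IsKappa n ℓ k × k ≤ length A
  fromShortest (inj₁ none) = contradiction (normalise-covered A-cov) (none _ (normalise-⊆ A))
  fromShortest (inj₂ (S , S⊆ , S-cov , shortest)) = length S , record
    { attained = S , covered⇒covering (⊆-unique S⊆ (perms-unique (suc n))) S-cov , refl
    ; minimal  = λ where _ (_ , B-cov , refl) → bound B-cov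
    } , bound A-cov
    where
    bound : ∀ {B} → IsCovering n ℓ B → length S ≤ length B
    bound {B} B-cov = ℕ.≤-trans (shortest _ (normalise-⊆ B) (normalise-covered B-cov)) (length-normalise B)

deficient : ℕ → List (Perm (suc n)) → List (Perm n)
deficient {n} ℓ S = filter (λ π → length (covers π S) ℕ.<? ℓ) (perms n)

length-concatMap-≤ : {A B : Set} (f : A → List B) {ℓ : ℕ} → (∀ x → length (f x) ≤ ℓ) →
                     ∀ xs → length (concatMap f xs) ≤ length xs ℕ.* ℓ
length-concatMap-≤ f     f≤ []       = z≤n
length-concatMap-≤ f {ℓ} f≤ (x ∷ xs) = subst (_≤ _) (sym (length-++ (f x)))
  (ℕ.+-mono-≤ (f≤ x) (length-concatMap-≤ f f≤ xs))

-- The ℓ distinct covers added for a deficient π suffice by themselves. Overlaps with S or among the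
-- repairs are therefore harmless, and deduplication only shortens the list.
completion : ∀ {ℓ} → ℓ ≤ n ℕ.^ 2 → {S : List (Perm (suc n))} → Unique S →
             ∃[ A ] IsCovering n ℓ A × length A ≤ length S ℕ.+ length (deficient ℓ S) ℕ.* ℓ
completion {n} {ℓ} ℓ≤n² {S} S-unique =
  result , covered⇒covering (DecUnique.deduplicate-! _≟ᴾ_ _) (All.universal covered _) ,
  (begin
    length result                                   ≤⟨ length-deduplicate _≟ᴾ_ candidates ⟩
    length candidates                               ≡⟨ length-++ S ⟩
    length S ℕ.+ length (concatMap new (deficient ℓ S))
      ≤⟨ ℕ.+-monoʳ-≤ (length S) (length-concatMap-≤ new (ℕ.≤-reflexive ∘ length-new) (deficient ℓ S)) ⟩
    length S ℕ.+ length (deficient ℓ S) ℕ.* ℓ   ∎)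
  where
  open ℕ.≤-Reasoning
  new : Perm n → List (Perm (suc n))
  new π = take ℓ (coverings π)

  candidates result : List (Perm (suc n))
  candidates = S ++ concatMap new (deficient ℓ S)
  result = deduplicate _≟ᴾ_ candidates

  length-new : ∀ π → length (new π) ≡ ℓ
  length-new π = trans (length-take ℓ (coverings π)) (ℕ.m≤n⇒m⊓n≡m (ℕ.≤-trans ℓ≤n² (length-coverings π)))

  covered : ∀ π → ℓ ≤ length (covers π result)
  covered π with length (covers π S) ℕ.<? ℓ
  ... | yes few = subst (_≤ length (covers π result)) (length-new π)
    (length-covers-≥ π (Unique.take⁺ ℓ (coverings-unique π)) (All.tabulate λ ρ∈new →
      ∈-deduplicate⁺ _≟ᴾ_ (∈-++⁺ʳ S (∈-concatMap⁺ new
        (lose (∈-filter⁺ (λ π → length (covers π S) ℕ.<? ℓ) (∈-perms π) few) ρ∈new))) ,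
      All.lookup (All.take⁺ ℓ (coverings-cover π)) ρ∈new))
  ... | no enough = ℕ.≤-trans (ℕ.≮⇒≥ enough) (Unique-length-≤ (Unique.filter⁺ (covers? π) S-unique)
    λ ρ∈ → let ρ∈S , c = ∈-filter⁻ (covers? π) {xs = S} ρ∈ in
      ∈-filter⁺ (covers? π) (∈-deduplicate⁺ _≟ᴾ_ (∈-++⁺ˡ ρ∈S)) c)

-- Rational arithmetic

ι : ℕ → ℚ
ι m = ℤ.+ m ℚ./ 1

toℚᵘ-/ : ∀ i d .{{_ : NonZero d}} → toℚᵘ (i ℚ./ d) ℚᵘ.≃ i ℚᵘ./ d
toℚᵘ-/ i (suc d) = ℚ.toℚᵘ-fromℚᵘ (ℚᵘ.mkℚᵘ i d)

ι-+ : ∀ m n → ι (m ℕ.+ n) ≡ ι m + ι n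
ι-+ m n = ℚ.toℚᵘ-injective (begin
  toℚᵘ (ι (m ℕ.+ n))                  ≈⟨ toℚᵘ-/ (ℤ.+ (m ℕ.+ n)) 1 ⟩
  ℤ.+ (m ℕ.+ n) ℚᵘ./ 1
    ≈⟨ ℚᵘ.*≡* (cong (ℤ._* (ℤ.+ 1)) (sym (cong₂ ℤ._+_ (ℤ.*-identityʳ (ℤ.+ m)) (ℤ.*-identityʳ (ℤ.+ n))))) ⟩
  (ℤ.+ m ℚᵘ./ 1) ℚᵘ.+ (ℤ.+ n ℚᵘ./ 1)      ≈⟨ ℚᵘ.+-cong (toℚᵘ-/ (ℤ.+ m) 1) (toℚᵘ-/ (ℤ.+ n) 1) ⟨
  toℚᵘ (ι m) ℚᵘ.+ toℚᵘ (ι n)          ≈⟨ ℚ.toℚᵘ-homo-+ (ι m) (ι n) ⟨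
  toℚᵘ (ι m + ι n)                    ∎) where open ℚᵘ.≃-Reasoning

ι-* : ∀ m n → ι (m ℕ.* n) ≡ ι m * ι n
ι-* m n = ℚ.toℚᵘ-injective (begin
  toℚᵘ (ι (m ℕ.* n))                  ≈⟨ toℚᵘ-/ (ℤ.+ (m ℕ.* n)) 1 ⟩
  ℤ.+ (m ℕ.* n) ℚᵘ./ 1                  ≈⟨ ℚᵘ.*≡* (cong (ℤ._* (ℤ.+ 1)) (ℤ.pos-* m n)) ⟩
  (ℤ.+ m ℚᵘ./ 1) ℚᵘ.* (ℤ.+ n ℚᵘ./ 1)      ≈⟨ ℚᵘ.*-cong (toℚᵘ-/ (ℤ.+ m) 1) (toℚᵘ-/ (ℤ.+ n) 1) ⟨
  toℚᵘ (ι m) ℚᵘ.* toℚᵘ (ι n)          ≈⟨ ℚ.toℚᵘ-homo-* (ι m) (ι n) ⟨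
  toℚᵘ (ι m * ι n)                    ∎) where open ℚᵘ.≃-Reasoning

/-*-ι : ∀ m d .{{_ : NonZero d}} → (ℤ.+ m ℚ./ d) * ι d ≡ ι m
/-*-ι m d@(suc _) = ℚ.toℚᵘ-injective (begin
  toℚᵘ ((ℤ.+ m ℚ./ d) * ι d)            ≈⟨ ℚ.toℚᵘ-homo-* (ℤ.+ m ℚ./ d) (ι d) ⟩
  toℚᵘ (ℤ.+ m ℚ./ d) ℚᵘ.* toℚᵘ (ι d)    ≈⟨ ℚᵘ.*-cong (toℚᵘ-/ (ℤ.+ m) d) (toℚᵘ-/ (ℤ.+ d) 1) ⟩
  (ℤ.+ m ℚᵘ./ d) ℚᵘ.* (ℤ.+ d ℚᵘ./ 1)
    ≈⟨ ℚᵘ.*≡* (trans (ℤ.*-identityʳ _) (cong (λ k → ℤ.+ m ℤ.* ℤ.+ k) (sym (ℕ.*-identityʳ d)))) ⟩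
  ℤ.+ m ℚᵘ./ 1                          ≈⟨ toℚᵘ-/ (ℤ.+ m) 1 ⟨
  toℚᵘ (ι m)                          ∎) where open ℚᵘ.≃-Reasoning

ι-mono-≤ : ∀ {m n} → m ≤ n → ι m ℚ.≤ ι n
ι-mono-≤ {m} {n} m≤n = ℚ.toℚᵘ-cancel-≤ (begin
  toℚᵘ (ι m)  ≃⟨ toℚᵘ-/ (ℤ.+ m) 1 ⟩
  ℤ.+ m ℚᵘ./ 1  ≤⟨ ℚᵘ.*≤* (ℤ.*-monoʳ-≤-nonNeg (ℤ.+ 1) (ℤ.+≤+ m≤n)) ⟩
  ℤ.+ n ℚᵘ./ 1  ≃⟨ toℚᵘ-/ (ℤ.+ n) 1 ⟨
  toℚᵘ (ι n)  ∎) where open ℚᵘ.≤-Reasoning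

ι-mono-< : ∀ {m n} → m ℕ.< n → ι m ℚ.< ι n
ι-mono-< {m} {n} m<n = ℚ.toℚᵘ-cancel-< (begin-strict
  toℚᵘ (ι m)  ≃⟨ toℚᵘ-/ (ℤ.+ m) 1 ⟩
  ℤ.+ m ℚᵘ./ 1  <⟨ ℚᵘ.*<* (ℤ.*-monoʳ-<-pos (ℤ.+ 1) (ℤ.+<+ m<n)) ⟩
  ℤ.+ n ℚᵘ./ 1  ≃⟨ toℚᵘ-/ (ℤ.+ n) 1 ⟨
  toℚᵘ (ι n)  ∎) where open ℚᵘ.≤-Reasoning

0≤ι : ∀ m → 0ℚ ℚ.≤ ι m
0≤ι m = ι-mono-≤ {0} {m} ℕ.z≤n

ι-suc : ∀ m → ι (suc m) ≡ 1ℚ + ι m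
ι-suc m = ι-+ 1 m

≤-respˡ : a ≡ b → a ℚ.≤ c → b ℚ.≤ c
≤-respˡ refl a≤c = a≤c

*-mono-≤ : 0ℚ ℚ.≤ a → a ℚ.≤ b → 0ℚ ℚ.≤ c → c ℚ.≤ d → a * c ℚ.≤ b * d
*-mono-≤ {a} {b} {c} {d} 0≤a a≤b 0≤c c≤d = ℚ.≤-trans
  (ℚ.*-monoʳ-≤-nonNeg c {{ℚ.nonNegative 0≤c}} a≤b)
  (ℚ.*-monoˡ-≤-nonNeg b {{ℚ.nonNegative (ℚ.≤-trans 0≤a a≤b)}} c≤d)

*-monoˡ-≤ : 0ℚ ℚ.≤ a → b ℚ.≤ c → a * b ℚ.≤ a * c
*-monoˡ-≤ {a} 0≤a = ℚ.*-monoˡ-≤-nonNeg a {{ℚ.nonNegative 0≤a}}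

*-monoʳ-≤ : 0ℚ ℚ.≤ a → b ℚ.≤ c → b * a ℚ.≤ c * a
*-monoʳ-≤ {a} 0≤a = ℚ.*-monoʳ-≤-nonNeg a {{ℚ.nonNegative 0≤a}}

0≤* : 0ℚ ℚ.≤ a → 0ℚ ℚ.≤ b → 0ℚ ℚ.≤ a * b
0≤* {a} 0≤a 0≤b = ≤-respˡ (ℚ.*-zeroʳ a) (*-monoˡ-≤ 0≤a 0≤b)

0≤+ : 0ℚ ℚ.≤ a → 0ℚ ℚ.≤ b → 0ℚ ℚ.≤ a + b
0≤+ = ℚ.+-mono-≤

≤-+ʳ : 0ℚ ℚ.≤ b → a ℚ.≤ a + b
≤-+ʳ {a = a} 0≤b = ≤-respˡ (ℚ.+-identityʳ a) (ℚ.+-monoʳ-≤ a 0≤b)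

0≤^ : ∀ k → 0ℚ ℚ.≤ a → 0ℚ ℚ.≤ a ^ᵠ k
0≤^ zero    0≤a = ι-mono-≤ {0} {1} ℕ.z≤n
0≤^ (suc k) 0≤a = 0≤* 0≤a (0≤^ k 0≤a)

^-monoˡ-≤ : ∀ k → 0ℚ ℚ.≤ a → a ℚ.≤ b → a ^ᵠ k ℚ.≤ b ^ᵠ k
^-monoˡ-≤ zero    0≤a a≤b = ℚ.≤-refl
^-monoˡ-≤ (suc k) 0≤a a≤b = *-mono-≤ 0≤a a≤b (0≤^ k 0≤a) (^-monoˡ-≤ k 0≤a a≤b)

^-antitoneʳ-≤ : ∀ {j k} → 0ℚ ℚ.≤ a → a ℚ.≤ 1ℚ → j ≤ k → a ^ᵠ k ℚ.≤ a ^ᵠ j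
^-antitoneʳ-≤ {k = zero}  0≤a a≤1 ℕ.z≤n = ℚ.≤-refl
^-antitoneʳ-≤ {a} {k = suc k} 0≤a a≤1 ℕ.z≤n = subst (a ^ᵠ suc k ℚ.≤_) (ℚ.*-identityˡ 1ℚ)
  (*-mono-≤ 0≤a a≤1 (0≤^ k 0≤a) (^-antitoneʳ-≤ {j = 0} {k} 0≤a a≤1 ℕ.z≤n))
^-antitoneʳ-≤ 0≤a a≤1 (ℕ.s≤s j≤k) = *-monoˡ-≤ 0≤a (^-antitoneʳ-≤ 0≤a a≤1 j≤k)

-- Sums over lists and expectations over random sublists

sumOver : List A → (A → ℚ) → ℚ
sumOver []       f = 0ℚ
sumOver (x ∷ xs) f = f x + sumOver xs f

sumOver-≤ : {f : A → ℚ} → (∀ x → f x ℚ.≤ c) → ∀ xs → sumOver xs f ℚ.≤ ι (length xs) * c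
sumOver-≤ {c = c} f≤c [] = ℚ.≤-reflexive (sym (ℚ.*-zeroˡ c))
sumOver-≤ {c = c} {f} f≤c (x ∷ xs) = begin
  f x + sumOver xs f          ≤⟨ ℚ.+-mono-≤ (f≤c x) (sumOver-≤ f≤c xs) ⟩
  c + ι (length xs) * c       ≡⟨ cong (_+ ι (length xs) * c) (ℚ.*-identityˡ c) ⟨
  1ℚ * c + ι (length xs) * c  ≡⟨ ℚ.*-distribʳ-+ c 1ℚ (ι (length xs)) ⟨
  (1ℚ + ι (length xs)) * c    ≡⟨ cong (_* c) (ι-suc (length xs)) ⟨
  ι (suc (length xs)) * c     ∎ where open ℚ.≤-Reasoning

length-filter-≤ : {P : A → Set} (P? : Decidable P) {f : A → ℚ} →
                  (∀ x → 0ℚ ℚ.≤ f x) → (∀ {x} → P x → 1ℚ ℚ.≤ f x) →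
                  ∀ xs → ι (length (filter P? xs)) ℚ.≤ sumOver xs f
length-filter-≤ P? 0≤f 1≤f []       = ℚ.≤-refl
length-filter-≤ P? 0≤f 1≤f (x ∷ xs) with P? x | length-filter-≤ P? 0≤f 1≤f xs
... | yes px | ih = ≤-respˡ (sym (ι-suc (length (filter P? xs)))) (ℚ.+-mono-≤ (1≤f px) ih)
... | no _   | ih = ≤-respˡ (ℚ.+-identityˡ _) (ℚ.+-mono-≤ (0≤f x) ih)

-- The expectation of f over the random sublist of xs that keeps each entry
-- independently with probability p and drops it with probability q.
module Expectation (p q : ℚ) (0≤p : 0ℚ ℚ.≤ p) (0≤q : 0ℚ ℚ.≤ q) (p+q≡1 : p + q ≡ 1ℚ) where

  E : List A → (List A → ℚ) → ℚ
  E []       f = f []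
  E (x ∷ xs) f = p * E xs (f ∘ (x ∷_)) + q * E xs f

  average : p * a + q * a ≡ a
  average {a} = trans (sym (ℚ.*-distribʳ-+ a p q)) (trans (cong (_* a) p+q≡1) (ℚ.*-identityˡ a))

  E-cong : {f g : List A → ℚ} (xs : List A) → (∀ S → f S ≡ g S) → E xs f ≡ E xs g
  E-cong []       f≡g = f≡g []
  E-cong (x ∷ xs) f≡g = cong₂ (λ s t → p * s + q * t) (E-cong xs (f≡g ∘ (x ∷_))) (E-cong xs f≡g)

  E-const : ∀ (xs : List A) c → E xs (λ _ → c) ≡ c
  E-const []       c = refl
  E-const (x ∷ xs) c = trans (cong (λ s → p * s + q * s) (E-const xs c)) average

  E-+ : ∀ (xs : List A) f g → E xs (λ S → f S + g S) ≡ E xs f + E xs g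
  E-+ []       f g = refl
  E-+ (x ∷ xs) f g = trans (cong₂ (λ s t → p * s + q * t) (E-+ xs _ _) (E-+ xs f g))
    (solve 6 (λ p q s t u v → p :* (s :+ t) :+ q :* (u :+ v) := (p :* s :+ q :* u) :+ (p :* t :+ q :* v)) refl
      p q (E xs (f ∘ (x ∷_))) (E xs (g ∘ (x ∷_))) (E xs f) (E xs g))

  E-* : ∀ (xs : List A) c f → E xs (λ S → c * f S) ≡ c * E xs f
  E-* []       c f = refl
  E-* (x ∷ xs) c f = trans (cong₂ (λ s t → p * s + q * t) (E-* xs c _) (E-* xs c f))
    (solve 5 (λ p q c s t → p :* (c :* s) :+ q :* (c :* t) := c :* (p :* s :+ q :* t)) refl
      p q c (E xs (f ∘ (x ∷_))) (E xs f))

  E-sumOver : {B : Set} (xs : List A) (ys : List B) (f : B → List A → ℚ) →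
              E xs (λ S → sumOver ys (λ y → f y S)) ≡ sumOver ys (λ y → E xs (f y))
  E-sumOver xs []       f = E-const xs 0ℚ
  E-sumOver xs (y ∷ ys) f = trans (E-+ xs (f y) _) (cong (E xs (f y) +_) (E-sumOver xs ys f))

  E-length : ∀ (xs : List A) → E xs (ι ∘ length) ≡ p * ι (length xs)
  E-length []       = sym (ℚ.*-zeroʳ p)
  E-length (x ∷ xs) = begin
    p * E xs (ι ∘ suc ∘ length) + q * E xs (ι ∘ length)
      ≡⟨ cong (λ s → p * s + q * E xs (ι ∘ length)) (trans (E-cong xs (ι-suc ∘ length))
           (trans (E-+ xs (λ _ → 1ℚ) _) (cong (_+ E xs (ι ∘ length)) (E-const xs 1ℚ)))) ⟩
    p * (1ℚ + E xs (ι ∘ length)) + q * E xs (ι ∘ length)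
      ≡⟨ solve 3 (λ p q e → p :* (con 1ℚ :+ e) :+ q :* e := p :+ (p :* e :+ q :* e))
           refl p q (E xs (ι ∘ length)) ⟩
    p + (p * E xs (ι ∘ length) + q * E xs (ι ∘ length))
      ≡⟨ cong (p +_) (trans average (E-length xs)) ⟩
    p + p * ι (length xs)
      ≡⟨ solve 2 (λ p e → p :+ p :* e := p :* (con 1ℚ :+ e)) refl p (ι (length xs)) ⟩
    p * (1ℚ + ι (length xs))
      ≡⟨ cong (p *_) (ι-suc (length xs)) ⟨
    p * ι (suc (length xs)) ∎ where open ≡-Reasoning

  -- The binomial generating function: by independence an entry that satisfies P contributes a
  -- factor q + p z, and any other entry p + q = 1.
  E-^ : {P : A → Set} (P? : Decidable P) (z : ℚ) (xs : List A) →
        E xs (λ S → z ^ᵠ length (filter P? S)) ≡ (q + p * z) ^ᵠ length (filter P? xs)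
  E-^ P? z [] = refl
  E-^ P? z (x ∷ xs) with P? x
  ... | yes px = begin
    p * E xs (λ S → z * z ^ᵠ length (filter P? S)) + q * E xs (λ S → z ^ᵠ length (filter P? S))
      ≡⟨ cong (λ s → p * s + q * E xs (λ S → z ^ᵠ length (filter P? S))) (E-* xs z _) ⟩
    p * (z * E xs (λ S → z ^ᵠ length (filter P? S))) + q * E xs (λ S → z ^ᵠ length (filter P? S))
      ≡⟨ solve 4 (λ p q z e → p :* (z :* e) :+ q :* e := (q :+ p :* z) :* e) refl p q z _ ⟩
    (q + p * z) * E xs (λ S → z ^ᵠ length (filter P? S))
      ≡⟨ cong ((q + p * z) *_) (E-^ P? z xs) ⟩
    (q + p * z) * (q + p * z) ^ᵠ length (filter P? xs) ∎ where open ≡-Reasoning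
  ... | no ¬px = trans average (E-^ P? z xs)

  -- Method of conditional expectations: a weighted mean of the two conditional values is at least
  -- the smaller one, and that branch is followed.
  sublist-≤-E : ∀ (xs : List A) f → ∃[ S ] S ⊆ xs × f S ℚ.≤ E xs f
  sublist-≤-E []       f = [] , [] , ℚ.≤-refl
  sublist-≤-E (x ∷ xs) f with ℚ.≤-total (E xs (f ∘ (x ∷_))) (E xs f)
  ... | inj₁ keep≤ with S , S⊆xs , fS≤ ← sublist-≤-E xs (f ∘ (x ∷_)) =
    x ∷ S , refl ∷ S⊆xs , ℚ.≤-trans fS≤ (≤-respˡ average
      (ℚ.+-monoʳ-≤ (p * E xs (f ∘ (x ∷_))) (*-monoˡ-≤ 0≤q keep≤)))
  ... | inj₂ drop≤ with S , S⊆xs , fS≤ ← sublist-≤-E xs f =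
    S , x ∷ʳ S⊆xs , ℚ.≤-trans fS≤ (≤-respˡ average
      (ℚ.+-monoˡ-≤ (q * E xs f) (*-monoˡ-≤ 0≤p drop≤)))

-- The exponential moment bound for random coverings

^-inverse : a * b ≡ 1ℚ → ∀ k → a ^ᵠ k * b ^ᵠ k ≡ 1ℚ
^-inverse ab≡1 zero    = refl
^-inverse {a} {b} ab≡1 (suc k) = trans
  (solve 4 (λ a b s t → (a :* s) :* (b :* t) := (a :* b) :* (s :* t)) refl a b (a ^ᵠ k) (b ^ᵠ k))
  (cong₂ _*_ ab≡1 (^-inverse ab≡1 k))

module _ (p q x z : ℚ) (0≤p : 0ℚ ℚ.≤ p) (0≤q : 0ℚ ℚ.≤ q) (p+q≡1 : p + q ≡ 1ℚ)
         (0≤x : 0ℚ ℚ.≤ x) (0≤z : 0ℚ ℚ.≤ z) (z≤1 : z ℚ.≤ 1ℚ) (xz≡1 : x * z ≡ 1ℚ) where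
  open Expectation p q 0≤p 0≤q p+q≡1

  -- As x is the inverse of z ≤ 1, the powers satisfy z^k ≥ z^r = 1 / x^r. The weights thus dominate
  -- the indicator of being covered at most r times, which is Markov's inequality for the
  -- exponential moment.
  1≤weight : ∀ {k r} → k ≤ r → 1ℚ ℚ.≤ x ^ᵠ r * z ^ᵠ k
  1≤weight {k} {r} k≤r = ≤-respˡ (^-inverse xz≡1 r)
    (*-monoˡ-≤ (0≤^ r 0≤x) (^-antitoneʳ-≤ 0≤z z≤1 k≤r))

  -- In `cost` the number of deficient permutations is replaced by the sum of all weights; unlike
  -- that number, this sum has an expectation that factors over the entries.
  small-covering : ∀ {n} r → suc r ≤ n ℕ.^ 2 → ∃[ A ] IsCovering n (suc r) A ×
    ι (length A) ℚ.≤ p * ι (suc n !) + ι (suc r) * (ι (n !) * (x ^ᵠ r * (q + p * z) ^ᵠ (n ℕ.^ 2)))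
  small-covering {n} r ℓ≤n² =
    let S , S⊆ , cost≤ = sublist-≤-E (perms (suc n)) cost
        A , A-cov , A≤ = completion ℓ≤n² (⊆-unique S⊆ (perms-unique (suc n)))
    in A , A-cov , ℚ.≤-trans (ℚ.≤-trans (ι-mono-≤ A≤) (size≤cost S)) (ℚ.≤-trans cost≤ E-cost)
    where
    open ℚ.≤-Reasoning
    weight : Perm n → List (Perm (suc n)) → ℚ
    weight π S = x ^ᵠ r * z ^ᵠ length (covers π S)

    cost : List (Perm (suc n)) → ℚ
    cost S = ι (length S) + ι (suc r) * sumOver (perms n) (λ π → weight π S)

    size≤cost : ∀ S → ι (length S ℕ.+ length (deficient (suc r) S) ℕ.* suc r) ℚ.≤ cost S
    size≤cost S = begin
      ι (length S ℕ.+ length (deficient (suc r) S) ℕ.* suc r)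
        ≡⟨ trans (ι-+ (length S) _) (cong (ι (length S) +_)
             (trans (ι-* (length (deficient (suc r) S)) (suc r))
                    (ℚ.*-comm (ι (length (deficient (suc r) S))) (ι (suc r))))) ⟩
      ι (length S) + ι (suc r) * ι (length (deficient (suc r) S))
        ≤⟨ ℚ.+-monoʳ-≤ (ι (length S)) (*-monoˡ-≤ (0≤ι (suc r))
             (length-filter-≤ (λ π → length (covers π S) ℕ.<? suc r)
               (λ π → 0≤* (0≤^ r 0≤x) (0≤^ (length (covers π S)) 0≤z))
               (λ where (ℕ.s≤s k≤r) → 1≤weight k≤r) (perms n))) ⟩
      cost S ∎

    0≤b : 0ℚ ℚ.≤ q + p * z
    0≤b = 0≤+ 0≤q (0≤* 0≤p 0≤z)

    b≤1 : q + p * z ℚ.≤ 1ℚ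
    b≤1 = begin
      q + p * z   ≤⟨ ℚ.+-monoʳ-≤ q (*-monoˡ-≤ 0≤p z≤1) ⟩
      q + p * 1ℚ  ≡⟨ cong (q +_) (ℚ.*-identityʳ p) ⟩
      q + p       ≡⟨ ℚ.+-comm q p ⟩
      p + q       ≡⟨ p+q≡1 ⟩
      1ℚ          ∎

    E-weight : ∀ π → E (perms (suc n)) (weight π) ℚ.≤ x ^ᵠ r * (q + p * z) ^ᵠ (n ℕ.^ 2)
    E-weight π = begin
      E (perms (suc n)) (weight π)
        ≡⟨ trans (E-* (perms (suc n)) (x ^ᵠ r) _) (cong (x ^ᵠ r *_) (E-^ (covers? π) z (perms (suc n)))) ⟩
      x ^ᵠ r * (q + p * z) ^ᵠ length (covers π (perms (suc n)))
        -- The base is at most 1, so lowering the exponent from the true number of covers to n² only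
        -- enlarges the power.
        ≤⟨ *-monoˡ-≤ (0≤^ r 0≤x) (^-antitoneʳ-≤ 0≤b b≤1 (ℕ.≤-trans (length-coverings π)
             (length-covers-≥ π (coverings-unique π) (All.map (∈-perms _ ,_) (coverings-cover π))))) ⟩
      x ^ᵠ r * (q + p * z) ^ᵠ (n ℕ.^ 2) ∎

    E-cost : E (perms (suc n)) cost ℚ.≤ p * ι (suc n !) + ι (suc r) * (ι (n !) * (x ^ᵠ r * (q + p * z) ^ᵠ (n ℕ.^ 2)))
    E-cost = begin
      E (perms (suc n)) cost
        ≡⟨ trans (E-+ (perms (suc n)) (ι ∘ length) _) (cong₂ _+_ (E-length (perms (suc n)))
             (trans (E-* (perms (suc n)) (ι (suc r)) _)
                    (cong (ι (suc r) *_) (E-sumOver (perms (suc n)) (perms n) weight)))) ⟩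
      p * ι (length (perms (suc n))) + ι (suc r) * sumOver (perms n) (λ π → E (perms (suc n)) (weight π))
        ≤⟨ ℚ.+-monoʳ-≤ (p * ι (length (perms (suc n)))) (*-monoˡ-≤ (0≤ι (suc r)) (sumOver-≤ E-weight (perms n))) ⟩
      p * ι (length (perms (suc n))) + ι (suc r) * (ι (length (perms n)) * (x ^ᵠ r * (q + p * z) ^ᵠ (n ℕ.^ 2)))
        ≡⟨ cong₂ (λ s t → p * ι s + ι (suc r) * (ι t * (x ^ᵠ r * (q + p * z) ^ᵠ (n ℕ.^ 2))))
             (length-perms (suc n)) (length-perms n) ⟩
      p * ι (suc n !) + ι (suc r) * (ι (n !) * (x ^ᵠ r * (q + p * z) ^ᵠ (n ℕ.^ 2))) ∎

-- Harmonic numbers and the exponential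

a+b-a : ∀ a b → a + (b - a) ≡ b
a+b-a = solve 2 (λ a b → a :+ (b :- a) := b) refl

≤-diff : 0ℚ ℚ.≤ d → a + d ≡ b → a ℚ.≤ b
≤-diff 0≤d refl = ≤-+ʳ 0≤d

0≤- : a ℚ.≤ b → 0ℚ ℚ.≤ b - a
0≤- {a} {b} a≤b = ≤-respˡ (ℚ.+-inverseʳ a) (ℚ.+-monoˡ-≤ (- a) a≤b)

-- The mean value inequality for powers. Divided by (j + 1)! it becomes the termwise inequality
-- behind `expSum-+`.
^-+-≤ : ∀ j → 0ℚ ℚ.≤ a → 0ℚ ℚ.≤ b → (a + b) ^ᵠ suc j ℚ.≤ a ^ᵠ suc j + ι (suc j) * (b * (a + b) ^ᵠ j)
^-+-≤ {a} {b} zero    0≤a 0≤b = ℚ.≤-reflexive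
  (solve 2 (λ a b → (a :+ b) :* con 1ℚ := a :* con 1ℚ :+ con 1ℚ :* (b :* con 1ℚ)) refl a b)
^-+-≤ {a} {b} (suc j) 0≤a 0≤b = begin
  (a + b) * s                                       ≡⟨ ℚ.*-distribʳ-+ s a b ⟩
  a * s + b * s                                     ≤⟨ ℚ.+-monoˡ-≤ (b * s) (*-monoˡ-≤ 0≤a (^-+-≤ j 0≤a 0≤b)) ⟩
  a * (a ^ᵠ suc j + ι (suc j) * (b * t)) + b * s
    ≡⟨ solve 6 (λ a u i b t s → a :* (u :+ i :* (b :* t)) :+ b :* s
         := a :* u :+ (i :* (b :* (a :* t)) :+ b :* s)) refl a (a ^ᵠ suc j) (ι (suc j)) b t s ⟩
  a ^ᵠ suc (suc j) + (ι (suc j) * (b * (a * t)) + b * s)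
    ≤⟨ ℚ.+-monoʳ-≤ (a ^ᵠ suc (suc j)) (ℚ.+-monoˡ-≤ (b * s) (*-monoˡ-≤ (0≤ι (suc j))
         (*-monoˡ-≤ 0≤b (*-monoʳ-≤ (0≤^ j (0≤+ 0≤a 0≤b)) (≤-+ʳ {b} {a} 0≤b))))) ⟩
  a ^ᵠ suc (suc j) + (ι (suc j) * (b * s) + b * s)
    ≡⟨ cong (a ^ᵠ suc (suc j) +_) (solve 2 (λ i w → i :* w :+ w := (con 1ℚ :+ i) :* w)
         refl (ι (suc j)) (b * s)) ⟩
  a ^ᵠ suc (suc j) + (1ℚ + ι (suc j)) * (b * s)
    ≡⟨ cong (λ i → a ^ᵠ suc (suc j) + i * (b * s)) (ι-suc (suc j)) ⟨
  a ^ᵠ suc (suc j) + ι (suc (suc j)) * (b * s)      ∎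
  where
  open ℚ.≤-Reasoning
  t = (a + b) ^ᵠ j
  s = (a + b) ^ᵠ suc j

1/! : ℕ → ℚ
1/! k = (ℤ.+ 1 ℚ./ k !) {{k ℕ.!≢0}}

1/!-* : ∀ k → 1/! k * ι (k !) ≡ 1ℚ
1/!-* k = /-*-ι 1 (k !) {{k ℕ.!≢0}}

1/!-suc : ∀ k → ι (suc k) * 1/! (suc k) ≡ 1/! k
1/!-suc k = begin
  i * X               ≡⟨ ℚ.*-identityʳ (i * X) ⟨
  i * X * 1ℚ          ≡⟨ cong (i * X *_) (1/!-* k) ⟨
  i * X * (Y * f)     ≡⟨ solve 4 (λ i X Y f → i :* X :* (Y :* f) := Y :* (X :* (i :* f))) refl i X Y f ⟩
  Y * (X * (i * f))   ≡⟨ cong (λ w → Y * (X * w)) (ι-* (suc k) (k !)) ⟨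
  Y * (X * ι (suc k !)) ≡⟨ cong (Y *_) (1/!-* (suc k)) ⟩
  Y * 1ℚ              ≡⟨ ℚ.*-identityʳ Y ⟩
  Y                   ∎
  where
  open ≡-Reasoning
  i = ι (suc k)
  f = ι (k !)
  X = 1/! (suc k)
  Y = 1/! k

0≤/ : ∀ k d .{{_ : NonZero d}} → 0ℚ ℚ.≤ ℤ.+ k ℚ./ d
0≤/ k d = ℚ.nonNegative⁻¹ (ℤ.+ k ℚ./ d) {{ℚ.normalize-nonNeg k d}}

0≤1/! : ∀ k → 0ℚ ℚ.≤ 1/! k
0≤1/! k = 0≤/ 1 (k !) {{k ℕ.!≢0}}

-- The mean value inequality exp (a + b) - exp a ≤ b exp (a + b), for partial sums.
expSum-+ : ∀ k → 0ℚ ℚ.≤ a → 0ℚ ℚ.≤ b → expSum (a + b) (suc k) ℚ.≤ expSum a (suc k) + b * expSum (a + b) k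
expSum-+ {a} {b} zero    0≤a 0≤b = ℚ.≤-reflexive
  (sym (trans (cong (expSum a 1 +_) (ℚ.*-zeroʳ b)) (ℚ.+-identityʳ (expSum a 1))))
expSum-+ {a} {b} (suc k) 0≤a 0≤b = begin
  expSum s (suc k) + s ^ᵠ suc k * X
    ≤⟨ ℚ.+-mono-≤ (expSum-+ k 0≤a 0≤b) (*-monoʳ-≤ (0≤1/! (suc k)) (^-+-≤ k 0≤a 0≤b)) ⟩
  (expSum a (suc k) + b * expSum s k) + (a ^ᵠ suc k + ι (suc k) * (b * s ^ᵠ k)) * X
    ≡⟨ solve 7 (λ e f u t X i b → (e :+ b :* f) :+ (u :+ i :* (b :* t)) :* X
         := (e :+ u :* X) :+ b :* (f :+ t :* (i :* X))) refl
         (expSum a (suc k)) (expSum s k) (a ^ᵠ suc k) (s ^ᵠ k) X (ι (suc k)) b ⟩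
  expSum a (suc (suc k)) + b * (expSum s k + s ^ᵠ k * (ι (suc k) * X))
    ≡⟨ cong (λ w → expSum a (suc (suc k)) + b * (expSum s k + s ^ᵠ k * w)) (1/!-suc k) ⟩
  expSum a (suc (suc k)) + b * expSum s (suc k) ∎
  where
  open ℚ.≤-Reasoning
  s = a + b
  X = 1/! (suc k)

expSum-≤-suc : ∀ k → 0ℚ ℚ.≤ a → expSum a k ℚ.≤ expSum a (suc k)
expSum-≤-suc k 0≤a = ≤-+ʳ (0≤* (0≤^ k 0≤a) (0≤1/! k))

expSum-0 : ∀ k → expSum 0ℚ (suc k) ≡ 1ℚ
expSum-0 zero    = refl
expSum-0 (suc k) = trans (cong₂ _+_ (expSum-0 k)
  (trans (cong (_* 1/! (suc k)) (ℚ.*-zeroˡ (0ℚ ^ᵠ k))) (ℚ.*-zeroˡ (1/! (suc k))))) (ℚ.+-identityʳ 1ℚ)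

recip : ℕ → ℚ
recip m = ℤ.+ 1 ℚ./ suc (suc m)

recip-* : ∀ m → recip m * ι (suc (suc m)) ≡ 1ℚ
recip-* m = /-*-ι 1 (suc (suc m))

0≤recip : ∀ m → 0ℚ ℚ.≤ recip m
0≤recip m = 0≤/ 1 (suc (suc m))

-- harmonic m = 1/2 + 1/3 + … + 1/(m + 1)
harmonic : ℕ → ℚ
harmonic zero    = 0ℚ
harmonic (suc m) = harmonic m + recip m

0≤harmonic : ∀ m → 0ℚ ℚ.≤ harmonic m
0≤harmonic zero    = ℚ.≤-refl
0≤harmonic (suc m) = 0≤+ (0≤harmonic m) (0≤recip m)

recip≤1 : ∀ m → recip m ℚ.≤ 1ℚ
recip≤1 m = begin
  recip m                     ≡⟨ ℚ.*-identityʳ (recip m) ⟨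
  recip m * ι 1               ≤⟨ *-monoˡ-≤ (0≤recip m) (ι-mono-≤ {1} {suc (suc m)} (s≤s z≤n)) ⟩
  recip m * ι (suc (suc m))   ≡⟨ recip-* m ⟩
  1ℚ                          ∎ where open ℚ.≤-Reasoning

harmonic≤ : ∀ m → harmonic m ℚ.≤ ι m
harmonic≤ zero    = ℚ.≤-refl
harmonic≤ (suc m) = begin
  harmonic m + recip m  ≤⟨ ℚ.+-mono-≤ (harmonic≤ m) (recip≤1 m) ⟩
  ι m + 1ℚ              ≡⟨ trans (ℚ.+-comm (ι m) 1ℚ) (sym (ι-suc m)) ⟩
  ι (suc m)             ∎ where open ℚ.≤-Reasoning

-- Adding 1/(m+2) to the argument gives P ≤ (m + 1) + P/(m + 2) for the new partial sum P, hence P ≤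
-- m + 2. The bound is uniform in k and so passes to the limit.
expSum-harmonic : ∀ m k → expSum (harmonic m) k ℚ.≤ ι (suc m)
expSum-harmonic zero    zero    = 0≤ι 1
expSum-harmonic zero    (suc k) = ℚ.≤-reflexive (expSum-0 k)
expSum-harmonic (suc m) k       = ℚ.*-cancelˡ-≤-pos j {{ℚ.positive (ι-mono-< {0} {suc m} (s≤s z≤n))}} (begin
  j * P                     ≡⟨ solve 2 (λ i P → i :* P := (con 1ℚ :+ i) :* P :- P) refl j P ⟩
  (1ℚ + j) * P - P          ≡⟨ cong (λ w → w * P - P) (ι-suc (suc m)) ⟨
  i * P - P                 ≤⟨ ℚ.+-monoˡ-≤ (- P) (*-monoˡ-≤ (0≤ι (suc (suc m))) bound) ⟩
  i * (j + β * P) - P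
    ≡⟨ solve 4 (λ i j β P → i :* (j :+ β :* P) :- P := j :* i :+ ((β :* i) :* P :- P)) refl i j β P ⟩
  j * i + ((β * i) * P - P) ≡⟨ cong (λ w → j * i + (w * P - P)) (recip-* m) ⟩
  j * i + (1ℚ * P - P)      ≡⟨ solve 3 (λ i j P → j :* i :+ (con 1ℚ :* P :- P) := j :* i) refl i j P ⟩
  j * i                     ∎)
  where
  open ℚ.≤-Reasoning
  i = ι (suc (suc m))
  j = ι (suc m)
  β = recip m
  P = expSum (harmonic (suc m)) k
  -- `expSum-+` has one more term on its left than in the sum multiplied by b; dropping that term
  -- puts the same P on both sides.
  bound : P ℚ.≤ j + β * P
  bound = ℚ.≤-trans (expSum-≤-suc k (0≤harmonic (suc m)))
    (ℚ.≤-trans (expSum-+ k (0≤harmonic m) (0≤recip m)) (ℚ.+-monoˡ-≤ (β * P) (expSum-harmonic m (suc k))))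

-- Decay of the Chernoff factor

bernoulli-≤ : ∀ M → 0ℚ ℚ.≤ c → c ℚ.≤ 1ℚ → (1ℚ - c) ^ᵠ M * (1ℚ + ι M * c) ℚ.≤ 1ℚ
bernoulli-≤ {c} zero    0≤c c≤1 = ℚ.≤-reflexive
  (solve 1 (λ c → con 1ℚ :* (con 1ℚ :+ con 0ℚ :* c) := con 1ℚ) refl c)
bernoulli-≤ {c} (suc M) 0≤c c≤1 = begin
  w * W * (1ℚ + ι (suc M) * c)     ≡⟨ cong (λ i → w * W * (1ℚ + i * c)) (ι-suc M) ⟩
  w * W * (1ℚ + (1ℚ + ι M) * c)    ≡⟨ solve 3 (λ W i c → (con 1ℚ :- c) :* W :* (con 1ℚ :+ (con 1ℚ :+ i) :* c)
         := W :* ((con 1ℚ :- c) :* (con 1ℚ :+ (con 1ℚ :+ i) :* c))) refl W (ι M) c ⟩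
  W * (w * (1ℚ + (1ℚ + ι M) * c))
    -- (1 - c)(1 + (M + 1) c) falls short of 1 + M c by exactly (M + 1) c².
    ≤⟨ *-monoˡ-≤ (0≤^ M (0≤- c≤1)) (≤-diff {d = (1ℚ + ι M) * (c * c)} (0≤* (0≤+ (0≤ι 1) (0≤ι M)) (0≤* 0≤c 0≤c))
         (solve 2 (λ i c → (con 1ℚ :- c) :* (con 1ℚ :+ (con 1ℚ :+ i) :* c) :+ (con 1ℚ :+ i) :* (c :* c)
            := con 1ℚ :+ i :* c) refl (ι M) c)) ⟩
  W * (1ℚ + ι M * c)               ≤⟨ bernoulli-≤ M 0≤c c≤1 ⟩
  1ℚ                               ∎
  where
  open ℚ.≤-Reasoning
  w = 1ℚ - c
  W = (1ℚ - c) ^ᵠ M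

1--*-≤ : 0ℚ ℚ.≤ a → 0ℚ ℚ.≤ b → 1ℚ - (a + b) ℚ.≤ (1ℚ - a) * (1ℚ - b)
1--*-≤ {a} {b} 0≤a 0≤b = ≤-diff (0≤* 0≤a 0≤b)
  (solve 2 (λ a b → (con 1ℚ :- (a :+ b)) :+ a :* b := (con 1ℚ :- a) :* (con 1ℚ :- b)) refl a b)

1-≤1 : 0ℚ ℚ.≤ a → 1ℚ - a ℚ.≤ 1ℚ
1-≤1 {a} 0≤a = ≤-diff 0≤a (solve 1 (λ a → con 1ℚ :- a :+ a := con 1ℚ) refl a)

^-≤1 : ∀ k → 0ℚ ℚ.≤ a → a ℚ.≤ 1ℚ → a ^ᵠ k ℚ.≤ 1ℚ
^-≤1 k 0≤a a≤1 = ^-antitoneʳ-≤ {j = 0} {k} 0≤a a≤1 z≤n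

module _ (M : ℕ) (κ : ℚ) (0≤κ : 0ℚ ℚ.≤ κ) (κM≡1 : ι M * κ ≡ 1ℚ) where

  -- One minus a sum is at most the product of the (1 - κ/i) for 2 ≤ i ≤ m + 1. Their M-th powers
  -- are at most i/(i + 1), with product 2/(m + 2). The hypothesis keeps the bases nonnegative, so
  -- that powers are monotone.
  decay-harmonic : ∀ m → harmonic m * κ ℚ.≤ 1ℚ → (1ℚ - harmonic m * κ) ^ᵠ M * ι (2 ℕ.+ m) ℚ.≤ ι 2
  decay-harmonic zero    u≤1 = *-monoʳ-≤ (0≤ι 2) (^-≤1 M (0≤- u≤1) (1-≤1 (0≤* ℚ.≤-refl 0≤κ)))
  decay-harmonic (suc m) u≤1 = begin
    (1ℚ - harmonic (suc m) * κ) ^ᵠ M * j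
      ≤⟨ *-monoʳ-≤ (0≤ι (3 ℕ.+ m)) (^-monoˡ-≤ M (0≤- u≤1) (≤-respˡ
           (cong (λ w → 1ℚ - w) (sym (ℚ.*-distribʳ-+ κ (harmonic m) β))) (1--*-≤ 0≤u 0≤v))) ⟩
    ((1ℚ - u) * (1ℚ - v)) ^ᵠ M * j
      ≡⟨ trans (cong (_* j) (^-distrib-* (1ℚ - u) (1ℚ - v) M)) (ℚ.*-assoc U V j) ⟩
    U * (V * j)
      ≤⟨ *-monoˡ-≤ (0≤^ M (0≤- u≤1′)) V-bound ⟩
    U * i
      ≤⟨ decay-harmonic m u≤1′ ⟩
    ι 2 ∎
    where
    open ℚ.≤-Reasoning
    β = recip m
    i = ι (2 ℕ.+ m)
    j = ι (3 ℕ.+ m)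
    u = harmonic m * κ
    v = β * κ
    U = (1ℚ - u) ^ᵠ M
    V = (1ℚ - v) ^ᵠ M
    0≤u : 0ℚ ℚ.≤ u
    0≤u = 0≤* (0≤harmonic m) 0≤κ
    0≤v : 0ℚ ℚ.≤ v
    0≤v = 0≤* (0≤recip m) 0≤κ
    u+v≤1 : u + v ℚ.≤ 1ℚ
    u+v≤1 = ≤-respˡ (ℚ.*-distribʳ-+ κ (harmonic m) β) u≤1
    u≤1′ : u ℚ.≤ 1ℚ
    u≤1′ = ℚ.≤-trans (≤-+ʳ 0≤v) u+v≤1
    v≤1 : v ℚ.≤ 1ℚ
    v≤1 = ℚ.≤-trans (≤-+ʳ 0≤u) (≤-respˡ (ℚ.+-comm u v) u+v≤1)
    V-bound : V * j ℚ.≤ i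
    V-bound = begin
      V * j                              ≡⟨ cong (V *_) (ι-suc (2 ℕ.+ m)) ⟩
      V * (1ℚ + i)
        -- Both inserted products equal 1; they turn 1 + i into (1 + M v) i, the form that
        -- `bernoulli-≤` bounds.
        ≡⟨ cong (λ w → V * (w + i)) (trans (cong₂ _*_ (recip-* m) κM≡1) (ℚ.*-identityˡ 1ℚ)) ⟨
      V * (β * i * (ι M * κ) + i)
        ≡⟨ solve 5 (λ V β i M κ → V :* (β :* i :* (M :* κ) :+ i) := V :* (con 1ℚ :+ M :* (β :* κ)) :* i)
             refl V β i (ι M) κ ⟩
      V * (1ℚ + ι M * v) * i             ≤⟨ *-monoʳ-≤ (0≤ι (2 ℕ.+ m)) (bernoulli-≤ M 0≤v v≤1) ⟩
      1ℚ * i                             ≡⟨ ℚ.*-identityˡ i ⟩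
      i                                  ∎

-- Separates the share of `harmonic m` from the r equal shares of `harmonic L`, so that each can
-- decay on its own.
weierstrass-≤ : ∀ r → 0ℚ ℚ.≤ a → 0ℚ ℚ.≤ b → b ℚ.≤ 1ℚ → 1ℚ - (a + ι r * b) ℚ.≤ (1ℚ - a) * (1ℚ - b) ^ᵠ r
weierstrass-≤ {a} {b} zero 0≤a 0≤b b≤1 = ℚ.≤-reflexive
  (solve 2 (λ a b → con 1ℚ :- (a :+ con 0ℚ :* b) := (con 1ℚ :- a) :* con 1ℚ) refl a b)
weierstrass-≤ {a} {b} (suc r) 0≤a 0≤b b≤1 = begin
  1ℚ - (a + ι (suc r) * b)            ≡⟨ cong (λ i → 1ℚ - (a + i * b)) (ι-suc r) ⟩
  1ℚ - (a + (1ℚ + ι r) * b)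
    ≡⟨ solve 3 (λ a b i → con 1ℚ :- (a :+ (con 1ℚ :+ i) :* b) := con 1ℚ :- ((a :+ i :* b) :+ b))
         refl a b (ι r) ⟩
  1ℚ - ((a + ι r * b) + b)            ≤⟨ 1--*-≤ (0≤+ 0≤a (0≤* (0≤ι r) 0≤b)) 0≤b ⟩
  (1ℚ - (a + ι r * b)) * (1ℚ - b)     ≤⟨ *-monoʳ-≤ (0≤- b≤1) (weierstrass-≤ r 0≤a 0≤b b≤1) ⟩
  (1ℚ - a) * (1ℚ - b) ^ᵠ r * (1ℚ - b)
    ≡⟨ solve 3 (λ x W w → x :* W :* w := x :* (w :* W)) refl (1ℚ - a) ((1ℚ - b) ^ᵠ r) (1ℚ - b) ⟩
  (1ℚ - a) * (1ℚ - b) ^ᵠ suc r        ∎ where open ℚ.≤-Reasoning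

-- The optimal choice of the probability

harmonic-mono : ∀ {i j} → i ℕ.≤′ j → harmonic i ℚ.≤ harmonic j
harmonic-mono (ℕ.≤′-reflexive refl) = ℚ.≤-refl
harmonic-mono {j = suc j} (ℕ.≤′-step i≤j) = ℚ.≤-trans (harmonic-mono i≤j) (≤-+ʳ (0≤recip j))

-- Up to constant factors, L + 2 and log m agree.
HarmonicFloor : ℕ → Set
HarmonicFloor m = ∃[ L ] ι (1 ℕ.+ L) ℚ.< harmonic m × harmonic m ℚ.≤ ι (3 ℕ.+ L)

-- The window has width 2 and a step is at most 1. After a move of the window a full unit lies
-- between the value and the new lower end, so the weak comparison of `≤-total` still yields a
-- strict bound.
harmonicFloor-suc : ∀ m → HarmonicFloor m → HarmonicFloor (suc m)
harmonicFloor-suc m (L , lower , upper) =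
  [ (λ small → L , ℚ.<-≤-trans lower (≤-+ʳ (0≤recip m)) , small)
  , (λ large → suc L , ℚ.<-≤-trans (ι-mono-< (ℕ.n<1+n (2 ℕ.+ L))) large , below)
  ]′ (ℚ.≤-total (harmonic (suc m)) (ι (3 ℕ.+ L)))
  where
  open ℚ.≤-Reasoning
  below : harmonic (suc m) ℚ.≤ ι (4 ℕ.+ L)
  below = begin
    harmonic m + recip m  ≤⟨ ℚ.+-mono-≤ upper (recip≤1 m) ⟩
    ι (3 ℕ.+ L) + 1ℚ      ≡⟨ trans (ℚ.+-comm (ι (3 ℕ.+ L)) 1ℚ) (sym (ι-suc (3 ℕ.+ L))) ⟩
    ι (4 ℕ.+ L)           ∎

harmonicFloor : ∀ k → HarmonicFloor (k ℕ.+ 3)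
-- 1/2 + 1/3 + 1/4 = 13/12 is the first of these sums to exceed 1.
harmonicFloor zero    = 0 , from-yes (ι 1 ℚ.<? harmonic 3) , harmonic≤ 3
harmonicFloor (suc k) = harmonicFloor-suc (k ℕ.+ 3) (harmonicFloor k)

^-comm : ∀ a j k → (a ^ᵠ j) ^ᵠ k ≡ (a ^ᵠ k) ^ᵠ j
^-comm a j k = trans (^-assocʳ a j k) (trans (cong (a ^ᵠ_) (ℕ.*-comm j k)) (sym (^-assocʳ a k j)))

-- Rational points below sums, multiples and logarithms

Below-+ : ∀ {x y} → Below x a → Below y b → Below (x +ᴿ y) (a + b)
Below-+ {x = x} {y} a∈x b∈y with a⁺ , a<a⁺ , a⁺∈x ← rounded x a∈x | b⁺ , b<b⁺ , b⁺∈y ← rounded y b∈y =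
  -- A supremum contains only rationals strictly below some member, so the members come from
  -- `rounded` and lie above a and b.
  ((a⁺ , a⁺∈x) , (b⁺ , b⁺∈y)) , ℚ.+-mono-< a<a⁺ b<b⁺

-- Only a positive factor preserves strictness. Applied to ℓ - 1, this is where ℓ ≥ 2 rather than ℓ
-- ≥ 1 matters.
Below-· : ∀ {m x} → 0 ℕ.< m → Below x a → Below (m / 1 · x) (ι m * a)
Below-· {m = m} {x} 0<m a∈x with a⁺ , a<a⁺ , a⁺∈x ← rounded x a∈x =
  (a⁺ , a⁺∈x) , ℚ.*-monoʳ-<-pos (ι m) {{ℚ.positive (ι-mono-< 0<m)}} a<a⁺

Below-log : ∀ {x} → exp b <ᴿ x → a ℚ.< b → Below (log x) a
Below-log exp<x a<b = (_ , exp<x) , a<b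

exp-harmonic-< : ∀ m {x} → Below x (ι (suc m)) → exp (harmonic m) <ᴿ x
exp-harmonic-< m below = ι (suc m) ,
  -- An eventual lower bound s of the partial sums is at most the K-th one, hence at most m + 1;
  -- convergence does not enter.
  (λ where ((s , K , s≤expSum) , q<s) →
             tt , ℚ.<-≤-trans q<s (ℚ.≤-trans (s≤expSum K ℕ.≤-refl) (expSum-harmonic m K))) , below

fromℕ-≤-· : ∀ {k m d} .{{_ : NonZero d}} {x} → Below x a → ι k ℚ.≤ (ℤ.+ m ℚ./ d) * a → fromℕ k ≤ᴿ m / d · x
fromℕ-≤-· a∈x k≤ (_ , q<k) = (_ , a∈x) , ℚ.<-≤-trans q<k k≤

-1-< : ∀ a → a - 1ℚ ℚ.< a
-1-< a = subst (a - 1ℚ ℚ.<_) (ℚ.+-identityʳ a) (ℚ.+-monoʳ-< a (ℚ.neg-antimono-< (ι-mono-< {0} {1} (s≤s z≤n))))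

module _ (r m L n : ℕ) .{{_ : NonZero n}} (n≡2+m : n ≡ 2 ℕ.+ m) (r+2≤n : 2 ℕ.+ r ≤ n)
         (lower : ι (1 ℕ.+ L) ℚ.< harmonic m) (upper : harmonic m ℚ.≤ ι (3 ℕ.+ L)) where

  private
    M = n ^ 2
    κ = (ℤ.+ 1 ℚ./ M) {{m^n≢0 n 2}}
    y x : ℚ
    y = harmonic m + ι r * harmonic L
    x = 1ℚ + y
    -- The first power comes from x ≤ (2 + r)(2 + L). The second collects a 2 from each of the r + 1
    -- telescoping products.
    K = ι (2 ℕ.+ r) ^ᵠ r * ι 2 ^ᵠ suc r

  0≤κ : 0ℚ ℚ.≤ κ
  0≤κ = 0≤/ 1 M {{m^n≢0 n 2}}

  κM≡1 : ι M * κ ≡ 1ℚ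
  κM≡1 = trans (ℚ.*-comm (ι M) κ) (/-*-ι 1 M {{m^n≢0 n 2}})

  0≤y : 0ℚ ℚ.≤ y
  0≤y = 0≤+ (0≤harmonic m) (0≤* (0≤ι r) (0≤harmonic L))

  1≤x : 1ℚ ℚ.≤ x
  1≤x = ≤-+ʳ 0≤y

  0≤x : 0ℚ ℚ.≤ x
  0≤x = 0≤+ (0≤ι 1) 0≤y

  -- This ties x to L + 2, whose r-th power `decay` cancels.
  x≤ : x ℚ.≤ ι (2 ℕ.+ r) * ι (2 ℕ.+ L)
  x≤ = begin
    1ℚ + (harmonic m + ι r * harmonic L)
      ≤⟨ ℚ.+-monoʳ-≤ 1ℚ (ℚ.+-mono-≤ upper (*-monoˡ-≤ (0≤ι r) (harmonic≤ L))) ⟩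
    1ℚ + (ι (3 ℕ.+ L) + ι r * ι L)
      ≡⟨ cong (1ℚ +_) (trans (cong (ι (3 ℕ.+ L) +_) (sym (ι-* r L))) (sym (ι-+ (3 ℕ.+ L) (r ℕ.* L)))) ⟩
    1ℚ + ι (3 ℕ.+ L ℕ.+ r ℕ.* L)
      ≡⟨ ι-suc (3 ℕ.+ L ℕ.+ r ℕ.* L) ⟨
    ι (4 ℕ.+ L ℕ.+ r ℕ.* L)
      ≤⟨ ι-mono-≤ nat ⟩
    ι ((2 ℕ.+ r) ℕ.* (2 ℕ.+ L))
      ≡⟨ ι-* (2 ℕ.+ r) (2 ℕ.+ L) ⟩
    ι (2 ℕ.+ r) * ι (2 ℕ.+ L) ∎
    where
    open ℚ.≤-Reasoning
    nat : 4 ℕ.+ L ℕ.+ r ℕ.* L ≤ (2 ℕ.+ r) ℕ.* (2 ℕ.+ L)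
    nat = ℕ.≤-trans (ℕ.m≤m+n _ (L ℕ.+ 2 ℕ.* r)) (ℕ.≤-reflexive
      (solveℕ 2 (λ r L → (con′ 4 :+′ L :+′ r :*′ L) :+′ (L :+′ con′ 2 :*′ r)
        :=′ (con′ 2 :+′ r) :*′ (con′ 2 :+′ L)) refl r L))
      where
      open ℕ.+-*-Solver using () renaming
        (solve to solveℕ; con to con′; _:=_ to _:=′_; _:+_ to _:+′_; _:*_ to _:*′_)

  L+2≤m : 2 ℕ.+ L ≤ m
  L+2≤m = ℕ.≮⇒≥ λ where
    (s≤s m≤1+L) → ℚ.<-irrefl refl (ℚ.<-≤-trans lower (ℚ.≤-trans (harmonic≤ m) (ι-mono-≤ m≤1+L)))

  -- Makes p = x κ a probability: of the two factors bounding x, both 2 + r and 2 + L are at most n.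
  x≤M : x ℚ.≤ ι M
  x≤M = ℚ.≤-trans x≤ (≤-respˡ (ι-* (2 ℕ.+ r) (2 ℕ.+ L)) (ι-mono-≤ (begin
    (2 ℕ.+ r) ℕ.* (2 ℕ.+ L)
      ≤⟨ ℕ.*-mono-≤ r+2≤n (ℕ.≤-trans L+2≤m (ℕ.≤-trans (ℕ.m≤n+m m 2) (ℕ.≤-reflexive (sym n≡2+m)))) ⟩
    n ℕ.* n                  ≡⟨ cong (n ℕ.*_) (ℕ.*-identityʳ n) ⟨
    M                        ∎)))
    where open ℕ.≤-Reasoning

  xκ≤1 : x * κ ℚ.≤ 1ℚ
  xκ≤1 = subst (x * κ ℚ.≤_) κM≡1 (*-monoʳ-≤ 0≤κ x≤M)

  yκ≤1 : y * κ ℚ.≤ 1ℚ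
  yκ≤1 = ℚ.≤-trans (*-monoʳ-≤ 0≤κ (subst (y ℚ.≤_) (ℚ.+-comm y 1ℚ) (≤-+ʳ (0≤ι 1)))) xκ≤1

  -- The factors are paired, U with n and each of the r copies of V with 2 + L; by `decay-harmonic`
  -- every pair is at most 2.
  decay : (1ℚ - y * κ) ^ᵠ M * (ι n * ι (2 ℕ.+ L) ^ᵠ r) ℚ.≤ ι 2 ^ᵠ suc r
  decay = begin
    (1ℚ - y * κ) ^ᵠ M * (ι n * J ^ᵠ r)
      ≤⟨ *-monoʳ-≤ (0≤* (0≤ι n) (0≤^ r (0≤ι (2 ℕ.+ L)))) (^-monoˡ-≤ M (0≤- yκ≤1) (≤-respˡ
           (cong (λ w → 1ℚ - w) (solve 4 (λ g i h κ → g :* κ :+ i :* (h :* κ) := (g :+ i :* h) :* κ)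
                refl (harmonic m) (ι r) (harmonic L) κ))
           (weierstrass-≤ r (0≤* (0≤harmonic m) 0≤κ) (0≤* (0≤harmonic L) 0≤κ) v≤1))) ⟩
    ((1ℚ - u) * (1ℚ - v) ^ᵠ r) ^ᵠ M * (ι n * J ^ᵠ r)
      ≡⟨ cong (_* (ι n * J ^ᵠ r)) (trans (^-distrib-* (1ℚ - u) ((1ℚ - v) ^ᵠ r) M)
           (cong (U *_) (^-comm (1ℚ - v) r M))) ⟩
    U * V ^ᵠ r * (ι n * J ^ᵠ r)
      ≡⟨ solve 4 (λ U W i w → U :* W :* (i :* w) := (U :* i) :* (W :* w)) refl U (V ^ᵠ r) (ι n) (J ^ᵠ r) ⟩
    U * ι n * (V ^ᵠ r * J ^ᵠ r)
      ≡⟨ cong (U * ι n *_) (^-distrib-* V J r) ⟨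
    U * ι n * (V * J) ^ᵠ r
      ≤⟨ *-mono-≤ (0≤* 0≤U (0≤ι n)) (subst (λ i → U * ι i ℚ.≤ ι 2) (sym n≡2+m) (decay-harmonic M κ 0≤κ κM≡1 m u≤1))
           (0≤^ r 0≤VJ) (^-monoˡ-≤ r 0≤VJ (decay-harmonic M κ 0≤κ κM≡1 L v≤1)) ⟩
    ι 2 ^ᵠ suc r ∎
    where
    open ℚ.≤-Reasoning
    J u v U V : ℚ
    J = ι (2 ℕ.+ L)
    u = harmonic m * κ
    v = harmonic L * κ
    U = (1ℚ - u) ^ᵠ M
    V = (1ℚ - v) ^ᵠ M
    u≤1 : u ℚ.≤ 1ℚ
    u≤1 = ℚ.≤-trans (*-monoʳ-≤ 0≤κ (≤-+ʳ {ι r * harmonic L} {harmonic m} (0≤* (0≤ι r) (0≤harmonic L)))) yκ≤1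
    v≤1 : v ℚ.≤ 1ℚ
    v≤1 = ℚ.≤-trans (*-monoʳ-≤ 0≤κ (harmonic-mono (ℕ.≤⇒≤′ (ℕ.≤-trans (ℕ.m≤n+m L 2) L+2≤m)))) u≤1
    0≤U : 0ℚ ℚ.≤ U
    0≤U = 0≤^ M (0≤- u≤1)
    0≤VJ : 0ℚ ℚ.≤ V * J
    0≤VJ = 0≤* (0≤^ M (0≤- v≤1)) (0≤ι (2 ℕ.+ L))

  decay-weight : ι n * (x ^ᵠ r * (1ℚ - y * κ) ^ᵠ M) ℚ.≤ K
  decay-weight = begin
    ι n * (x ^ᵠ r * D)
      ≤⟨ *-monoˡ-≤ (0≤ι n) (*-monoʳ-≤ (0≤^ M (0≤- yκ≤1)) (^-monoˡ-≤ r 0≤x x≤)) ⟩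
    ι n * ((I * J) ^ᵠ r * D)
      ≡⟨ cong (λ w → ι n * (w * D)) (^-distrib-* I J r) ⟩
    ι n * (I ^ᵠ r * J ^ᵠ r * D)
      ≡⟨ solve 4 (λ i w t D → i :* (w :* t :* D) := w :* (D :* (i :* t))) refl (ι n) (I ^ᵠ r) (J ^ᵠ r) D ⟩
    I ^ᵠ r * (D * (ι n * J ^ᵠ r))
      ≤⟨ *-monoˡ-≤ (0≤^ r (0≤ι (2 ℕ.+ r))) decay ⟩
    K ∎
    where
    open ℚ.≤-Reasoning
    I = ι (2 ℕ.+ r)
    J = ι (2 ℕ.+ L)
    D = (1ℚ - y * κ) ^ᵠ M

  covering-≤ : ∃[ A ] IsCovering n (suc r) A ×
               ι (length A) ℚ.≤ (ℤ.+ (suc n !) ℚ./ M) {{m^n≢0 n 2}} * (x + ι (suc r) * K)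
  covering-≤ =
   let A , A-cov , A≤ = small-covering (x * κ) (1ℚ - x * κ) x z (0≤* 0≤x 0≤κ) (0≤- xκ≤1)
                          (a+b-a (x * κ) 1ℚ) 0≤x 0≤z z≤1 xz≡1 r ℓ≤M
   in A , A-cov , (begin
    ι (length A)
      ≤⟨ A≤ ⟩
    x * κ * N + ι (suc r) * (ι (n !) * (x ^ᵠ r * (1ℚ - x * κ + x * κ * z) ^ᵠ M))
      ≡⟨ cong (λ w → x * κ * N + ι (suc r) * (ι (n !) * (x ^ᵠ r * w ^ᵠ M))) b≡ ⟩
    x * κ * N + ι (suc r) * (ι (n !) * W)
      ≤⟨ ℚ.+-monoʳ-≤ (x * κ * N) (*-monoˡ-≤ (0≤ι (suc r)) extra) ⟩
    x * κ * N + ι (suc r) * (κ * N * K)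
      ≡⟨ solve 5 (λ x κ N i K → x :* κ :* N :+ i :* (κ :* N :* K) := κ :* N :* (x :+ i :* K))
           refl x κ N (ι (suc r)) K ⟩
    κ * N * (x + ι (suc r) * K)
      ≡⟨ cong (_* (x + ι (suc r) * K)) κN≡F ⟩
    F * (x + ι (suc r) * K) ∎)
    where
    open ℚ.≤-Reasoning
    N F W z : ℚ
    N = ι (suc n !)
    F = (ℤ.+ (suc n !) ℚ./ M) {{m^n≢0 n 2}}
    W = x ^ᵠ r * (1ℚ - y * κ) ^ᵠ M
    x-pos : ℚ.Positive x
    x-pos = ℚ.positive (ℚ.<-≤-trans (ι-mono-< {0} {1} (s≤s z≤n)) 1≤x)
    z = (ℚ.1/ x) {{ℚ.pos⇒nonZero x {{x-pos}}}}
    xz≡1 : x * z ≡ 1ℚ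
    xz≡1 = ℚ.*-inverseʳ x {{ℚ.pos⇒nonZero x {{x-pos}}}}
    0≤z : 0ℚ ℚ.≤ z
    0≤z = ℚ.<⇒≤ (ℚ.positive⁻¹ z {{ℚ.1/pos⇒pos x {{x-pos}}}})
    z≤1 : z ℚ.≤ 1ℚ
    z≤1 = subst (z ℚ.≤_) xz≡1 (≤-respˡ (ℚ.*-identityˡ z) (*-monoʳ-≤ 0≤z 1≤x))
    ℓ≤M : suc r ≤ M
    ℓ≤M = ℕ.≤-trans (ℕ.≤-trans (ℕ.n≤1+n (suc r)) r+2≤n) (ℕ.m≤m*n n (n ^ 1) {{m^n≢0 n 1}})
    -- As x z = 1, the term p z is just κ. The summand 1 in x = 1 + y is there to absorb it.
    b≡ : 1ℚ - x * κ + x * κ * z ≡ 1ℚ - y * κ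
    b≡ = begin-equality
      1ℚ - x * κ + x * κ * z
        ≡⟨ solve 3 (λ x κ z → con 1ℚ :- x :* κ :+ x :* κ :* z := con 1ℚ :- x :* κ :+ κ :* (x :* z)) refl x κ z ⟩
      1ℚ - x * κ + κ * (x * z)  ≡⟨ cong (λ w → 1ℚ - x * κ + κ * w) xz≡1 ⟩
      1ℚ - x * κ + κ * 1ℚ
        ≡⟨ solve 2 (λ y κ → con 1ℚ :- (con 1ℚ :+ y) :* κ :+ κ :* con 1ℚ := con 1ℚ :- y :* κ) refl y κ ⟩
      1ℚ - y * κ                ∎
    κN≡F : κ * N ≡ F
    κN≡F = begin-equality
      κ * N            ≡⟨ cong (κ *_) (/-*-ι (suc n !) M {{m^n≢0 n 2}}) ⟨
      κ * (F * ι M)    ≡⟨ solve 3 (λ κ F M → κ :* (F :* M) := F :* (M :* κ)) refl κ F (ι M) ⟩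
      F * (ι M * κ)    ≡⟨ cong (F *_) κM≡1 ⟩
      F * 1ℚ           ≡⟨ ℚ.*-identityʳ F ⟩
      F                ∎
    extra : ι (n !) * W ℚ.≤ κ * N * K
    extra = begin
      ι (n !) * W                          ≡⟨ ℚ.*-identityʳ (ι (n !) * W) ⟨
      ι (n !) * W * 1ℚ                     ≡⟨ cong (ι (n !) * W *_) κM≡1 ⟨
      ι (n !) * W * (ι M * κ)
        ≡⟨ cong (λ w → ι (n !) * W * (w * κ)) (trans (cong (λ w → ι (n ℕ.* w)) (ℕ.*-identityʳ n)) (ι-* n n)) ⟩
      ι (n !) * W * (ι n * ι n * κ)
        ≡⟨ solve 4 (λ f W i κ → f :* W :* (i :* i :* κ) := κ :* (i :* f) :* (i :* W)) refl (ι (n !)) W (ι n) κ ⟩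
      -- One factor n raises n! to at most (n + 1)!; the other is consumed by the O(1/n) decay of W.
      κ * (ι n * ι (n !)) * (ι n * W)      ≤⟨ *-mono-≤ (0≤* 0≤κ (0≤* (0≤ι n) (0≤ι (n !))))
           (*-monoˡ-≤ 0≤κ (≤-respˡ (ι-* n (n !)) (ι-mono-≤ (ℕ.m≤n+m (n ℕ.* n !) (n !)))))
           (0≤* (0≤ι n) (0≤* (0≤^ r 0≤x) (0≤^ M (0≤- yκ≤1)))) decay-weight ⟩
      κ * N * K                            ∎

-- Lowering both harmonic sums by 1 makes them strict lower bounds of the two
-- logarithms; the constant 2 + r + w compensates for this.
≤-log-bound : ∀ {k n d D} .{{_ : NonZero D}} r m L w → 0 ℕ.< r → suc m ℕ.< n → ι (1 ℕ.+ L) ℚ.< harmonic m →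
  ι k ℚ.≤ (ℤ.+ d ℚ./ D) * (1ℚ + (harmonic m + ι r * harmonic L) + w) →
  fromℕ k ≤ᴿ d / D · (log (fromℕ n) +ᴿ r / 1 · log (log (fromℕ n)) +ᴿ ↑ (ι 2 + ι r + w + 1ℚ))
≤-log-bound {k} {n} {d} {D} r m L w 0<r 1+m<n lower k≤ = fromℕ-≤-· {k = k} {m = d} {D}
  {x = log n̄ +ᴿ r / 1 · log (log n̄) +ᴿ ↑ (offset + 1ℚ)}
  (Below-+ {x = log n̄ +ᴿ r / 1 · log (log n̄)} {↑ (offset + 1ℚ)}
    (Below-+ {x = log n̄} {r / 1 · log (log n̄)} (Below-log {x = n̄} log-n (-1-< (harmonic m)))
      (Below-· {x = log (log n̄)} 0<r (Below-log {x = log n̄} loglog-n (-1-< (harmonic L)))))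
    (tt , offset<))
  (subst (λ t → ι k ℚ.≤ (ℤ.+ d ℚ./ D) * t) total k≤)
  where
  offset : ℚ
  offset = ι 2 + ι r + w
  n̄ : ℝ̄
  n̄ = fromℕ n
  log-n : exp (harmonic m) <ᴿ n̄
  log-n = exp-harmonic-< m {n̄} (tt , ι-mono-< 1+m<n)
  loglog-n : exp (harmonic L) <ᴿ log n̄
  loglog-n = exp-harmonic-< L {log n̄} (Below-log {x = n̄} log-n lower)
  -- The cut of a rational holds only strictly smaller ones, whence the final 1 in the constant.
  offset< : offset ℚ.< offset + 1ℚ
  offset< = subst (ℚ._< offset + 1ℚ) (ℚ.+-identityʳ offset) (ℚ.+-monoʳ-< offset (ι-mono-< {0} {1} (s≤s z≤n)))
  total : 1ℚ + (harmonic m + ι r * harmonic L) + w ≡ ((harmonic m - 1ℚ) + ι r * (harmonic L - 1ℚ)) + offset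
  total = solve 4 (λ h i g w → con 1ℚ :+ (h :+ i :* g) :+ w
      := ((h :- con 1ℚ) :+ i :* (g :- con 1ℚ)) :+ (con (ι 2) :+ i :+ w))
    refl (harmonic m) (ι r) (harmonic L) w

-- The bound for the cost of all repairs, in units of (n + 1)!/n².
overhead : ℕ → ℚ
overhead r = ι (suc r) * (ι (2 ℕ.+ r) ^ᵠ r * ι 2 ^ᵠ suc r)

kappa-bound : ∀ r ℓ → 0 ℕ.< r → ℓ ≡ suc r → ∀ n .{{_ : NonZero n}} → 4 ℕ.+ ℓ ≤ n → ∃[ k ] IsKappa n ℓ k ×
    fromℕ k ≤ᴿ _/_·_ (suc n !) (n ^ 2) {{m^n≢0 n 2}}
    (log (fromℕ n) +ᴿ r / 1 · log (log (fromℕ n)) +ᴿ ↑ (ι 2 + ι r + overhead r + 1ℚ))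
kappa-bound r ℓ 0<r refl n N≤n =
  let j , N+j≡n = ℕ.m≤n⇒∃[o]m+o≡n N≤n
      -- n = m + 2 is the number to which the decay of `harmonic m` telescopes, and 4 + ℓ ≤ n makes
      -- m at least 3, where `harmonicFloor` starts.
      m = r ℕ.+ j ℕ.+ 3
      2+m≡n = trans (cong (2 ℕ.+_) (ℕ.+-comm (r ℕ.+ j) 3)) N+j≡n
      L , lower , upper = harmonicFloor (r ℕ.+ j)
      A , A-cov , A≤ = covering-≤ r m L n (sym 2+m≡n) (ℕ.≤-trans (ℕ.m≤n+m (2 ℕ.+ r) 3) N≤n) lower upper
      k , κ-k , k≤A = kappa-≤ A-cov
  in k , κ-k , ≤-log-bound {k} {n} {suc n !} {n ^ 2} {{m^n≢0 n 2}} r m L (overhead r) 0<r (ℕ.≤-reflexive 2+m≡n) lower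
       (ℚ.≤-trans (ι-mono-≤ {k} {length A} k≤A) A≤)

theorem3 : (ℓ : ℕ) → 2 ≤ ℓ →
    ∃[ C ] ∃[ N ] ∀ (n : ℕ) .{{_ : NonZero n}} → N ≤ n →
    ∃[ k ] IsKappa n ℓ k ×
    fromℕ k ≤ᴿ _/_·_ (suc n !) (n ^ 2) {{m^n≢0 n 2}}
    (log (fromℕ n) +ᴿ (ℓ ∸ 1) / 1 · log (log (fromℕ n)) +ᴿ ↑ C)
theorem3 ℓ 2≤ℓ = ι 2 + ι (ℓ ∸ 1) + overhead (ℓ ∸ 1) + 1ℚ , 4 ℕ.+ ℓ , λ n N≤n →
  kappa-bound (ℓ ∸ 1) ℓ (ℕ.m<n⇒0<n∸m 2≤ℓ) (sym (ℕ.m+[n∸m]≡n (ℕ.≤-trans (ℕ.n≤1+n 1) 2≤ℓ))) n N≤n
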